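{- For every integer $t\geq 3$ there is a constant $C(t)$, depending only on $t$, such that the following holds. Let $n,m$ be positive integers with $$2m\geq \max \Big\{(t+1)(t+C(t)+2)+3,\ \frac{(t-1)^{2}}{t-2}\big((n-1)(t-1)+2\big)\Big\}.$$ Then $r(F_{m}, F_{t,n})\leq \max\{m,n\}+(t-1)(2m+n)+n+m$.
   Context: For graphs $G,H$, the Ramsey number $r(G,H)$ is the least integer $r$ such that every red/blue edge-coloring of the complete graph $K_r$ contains a red copy of $G$ or a blue copy of $H$. The generalized fan $F_{t,n}$ is $K_1+nK_t$, the join of a single vertex with the disjoint union of $n$ copies of $K_t$; the fan $F_m$ is $F_{2,m}=K_1+mK_2$. -}

module Defs where

open import Data.Nat using (ℕ; suc)
open import Data.Fin using (Fin)
open import Data.Bool using (Bool; true; false)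
open import Data.Maybe using (Maybe; just; nothing)
open import Data.Product using (_×_; _,_; Σ; ∃)
open import Data.Sum using (_⊎_)
open import Data.Empty using (⊥)
open import Relation.Nullary using (¬_)
open import Relation.Binary.PropositionalEquality using (_≡_; _≢_)
open import Function.Definitions using (Injective)

record Graph : Set₁ where
  field
    V   : Set
    Adj : V → V → Set
open Graph public

-- A red/blue edge-colouring of the complete graph K_N on vertex set Fin N.
-- true = red, false = blue.  Only the colours of pairs i ≠ j matter;
-- symmetry makes it a colouring of unordered pairs.
record Colouring (N : ℕ) : Set where
  field
    col : Fin N → Fin N → Bool
    sym : ∀ i j → col i j ≡ col j i
open Colouring public

MonoCopy : {N : ℕ} → Colouring N → Bool → Graph → Set
MonoCopy {N} c b G =
  Σ (V G → Fin N) λ f →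
    Injective _≡_ _≡_ f × (∀ u v → Adj G u v → col c (f u) (f v) ≡ b)

Arrows : ℕ → Graph → Graph → Set
Arrows N G H = (c : Colouring N) → MonoCopy c true G ⊎ MonoCopy c false H

-- r(G,H) ≤ N.  Since the arrow property is monotone in N (restrict a
-- colouring of a larger K to a sub-K_N), r(G,H) ≤ N iff K_N → (G,H).
RamseyLE : Graph → Graph → ℕ → Set
RamseyLE G H N = Arrows N G H

-- Generalized fan F_{t,n} = K_1 + n K_t.
-- Vertices: nothing = the centre; just (i , a) = vertex a of the i-th copy of K_t.
fanAdj : (t n : ℕ) → Maybe (Fin n × Fin t) → Maybe (Fin n × Fin t) → Set
fanAdj t n nothing  nothing  = ⊥
fanAdj t n nothing  (just _) = Data.Unit.⊤ where import Data.Unit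
fanAdj t n (just _) nothing  = Data.Unit.⊤ where import Data.Unit
fanAdj t n (just (i , a)) (just (j , b)) = (i ≡ j) × (a ≢ b)

GenFan : ℕ → ℕ → Graph
GenFan t n = record { V = Maybe (Fin n × Fin t) ; Adj = fanAdj t n }

Fan : ℕ → Graph
Fan m = GenFan 2 m

{-# OPTIONS --safe #-}

-- Since m ≥ n, the bound is t (2m + n) = (2m + (t-1) n) + ((t-1) 2m + n), so some vertex has at
-- least 2m + (t-1) n red or at least (t-1) 2m + n blue neighbours.
--
-- In a red neighbourhood of that size, a red matching with fewer than m edges that cannot be
-- augmented leaves a large blue clique U, and every matching edge has an end with at most one red
-- neighbour in U; these ends together with U contain a blue F_{t,n}.
--
-- In a blue neighbourhood of that size n disjoint blue K_t are found as follows, assuming that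
-- there is no red F_m. Delete greedily chosen blue K_t until the rest W has none. Red degrees in W
-- are at most 2m + t - 3, so by the Andrásfai–Erdős–Sós theorem W is a union of t - 1 red cliques.
-- Every vertex is red to almost all of at most one of these cliques. The vertices attached to
-- one clique beyond the first 2m give disjoint blue edges, by the augmentation argument with the
-- colours exchanged, and counting shows that these edges and the unattached vertices are n
-- disjoint seeds. Each seed extends greedily through the cliques to a blue K_t.
module Submission where

open import Defs hiding (sym)
open import Data.Nat using (ℕ; zero; suc; _+_; _*_; _∸_; _≤_; _<_; z≤n; s≤s; _≤?_; _⊔_)
import Data.Nat as Nat
open import Data.Nat.Properties hiding (_≟_)
open import Algebra.Properties.CommutativeSemigroup +-commutativeSemigroup using (interchange; x∙yz≈y∙xz)
open import Data.Nat.ListAction using (sum)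
open import Data.Nat.ListAction.Properties using (sum-↭)
open import Data.Nat.Tactic.RingSolver using (solve-∀)
open import Data.Bool using (Bool; true; false; not; _∧_; _∨_; if_then_else_)
import Data.Bool as Bool
open import Data.Bool.Properties using (¬-not; not-¬)
open import Data.Empty using (⊥; ⊥-elim)
open import Data.Fin using (Fin; cast; toℕ; fromℕ<) renaming (_≟_ to _≟ᶠ_)
import Data.Fin.Properties as Fin
open import Data.List using (List; []; _∷_; _++_; length; map; filterᵇ; replicate; take; drop; allFin; downFrom; lookup)
import Data.List.Properties as List
open import Data.List.Membership.Propositional using (_∈_; _∉_; find; lose)
open import Data.List.Membership.Propositional.Properties
  using (∈-++⁺ˡ; ∈-++⁺ʳ; ∈-++⁻; ∈-lookup; ∈-allFin; ∈-downFrom⁻; ∈-downFrom⁺)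
open import Data.List.Relation.Binary.Permutation.Propositional
  using (_↭_; ↭-refl; ↭-sym; ↭-trans; prep; swap; ↭⇒↭ₛ)
open import Data.List.Relation.Binary.Permutation.Propositional.Properties
  using (shift; map⁺; ↭-length; ∈-resp-↭; ++⁺ˡ; ++⁺ʳ; ++-comm; ++⁺)
import Data.List.Relation.Binary.Permutation.Setoid.Properties as ↭ₛ
open import Data.List.Relation.Unary.All as All using (All; []; _∷_)
import Data.List.Relation.Unary.All.Properties as All
open import Data.List.Relation.Unary.AllPairs as AllPairs using (AllPairs; []; _∷_)
import Data.List.Relation.Unary.AllPairs.Properties as AllPairs
open import Data.List.Relation.Unary.Any as Any using (Any; here; there)
open import Data.List.Relation.Unary.Unique.Propositional using (Unique)
open import Data.List.Relation.Unary.Unique.Propositional.Properties using (downFrom⁺; allFin⁺)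
open import Data.Maybe using (Maybe; just; nothing)
open import Data.Product using (∃; ∃₂; _×_; _,_; proj₁; proj₂)
open import Data.Sum using (_⊎_; inj₁; inj₂; [_,_]′)
open import Function using (_∘_; id; case_of_)
open import Relation.Binary.Definitions using (DecidableEquality; Symmetric)
open import Relation.Binary.PropositionalEquality
  using (_≡_; _≢_; refl; sym; trans; cong; cong₂; subst; setoid)
open import Relation.Nullary using (¬_; Dec; yes; no; does)
open import Relation.Nullary.Decidable as Dec using (dec-true; dec-false; _×-dec_; ¬?)

-- The size `(t-1) 2m + n` asked of a blue neighbourhood leaves no slack: `t - 1` disjoint red
-- cliques on `2m` vertices each, blue in between, contain neither a red `F_m` nor a blue `K_t`. A
-- surplus of `n` vertices has to yield `n` blue `K_t`, so seeds must be counted exactly, while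
-- their extension may be wasteful. Write `q = t - 2` and `p = n - 1`. A class of `W` has at most
-- `2m` vertices, and the total `Δ` by which the classes fall short of `2m` is below `(q+1) p`. A
-- vertex has at most `2m` red neighbours in two classes together, since more would force a blue
-- triangle inside a union of two red cliques. Hence being red to almost all of one class means
-- being blue to almost all of every other class. The `p` other blue cliques block at most `p`
-- vertices of a class, one each. Greedy extension therefore succeeds once `2m` is large against
-- `Δ`, `p` and `q`. This is one source of the lower bounds on `2m`; the density required by the
-- Andrásfai-Erdős-Sós theorem is the other.

private variable
  A : Set

-- X ≤ Y follows from P ≤ Q once the ring solver checks X + Q + slack ≡ Y + P.
linear : ∀ {P Q} X Y slack → P ≤ Q → X + Q + slack ≡ Y + P → X ≤ Y
linear {P} {Q} X Y slack P≤Q eq = +-cancelʳ-≤ Q X Y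
  (≤-trans (m≤m+n (X + Q) slack) (≤-trans (≤-reflexive eq) (+-monoʳ-≤ Y P≤Q)))

bool-cases : (b : Bool) → b ≡ true ⊎ b ≡ false
bool-cases true  = inj₁ refl
bool-cases false = inj₂ refl

false≢true : ∀ {b} → b ≡ false → b ≡ true → ⊥
false≢true refl ()

not-true : ∀ {b} → not b ≡ true → b ≡ false
not-true {false} _ = refl

-- Counting list entries that satisfy a Boolean predicate

bit : Bool → ℕ
bit true  = 1
bit false = 0

bit≤1 : ∀ b → bit b ≤ 1
bit≤1 true  = s≤s z≤n
bit≤1 false = z≤n

cnt : (A → Bool) → List A → ℕ
cnt p []       = 0
cnt p (x ∷ xs) = bit (p x) + cnt p xs

cnt-++ : ∀ (p : A → Bool) xs ys → cnt p (xs ++ ys) ≡ cnt p xs + cnt p ys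
cnt-++ p []       ys = refl
cnt-++ p (x ∷ xs) ys = trans (cong (bit (p x) +_) (cnt-++ p xs ys)) (sym (+-assoc (bit (p x)) _ _))

cnt-mono : ∀ {p q : A → Bool} xs → (∀ {x} → x ∈ xs → p x ≡ true → q x ≡ true) → cnt p xs ≤ cnt q xs
cnt-mono []       f = z≤n
cnt-mono {p = p} {q} (x ∷ xs) f = +-mono-≤ head (cnt-mono xs (f ∘ there))
  where
  head : bit (p x) ≤ bit (q x)
  head with p x in eq
  ... | false = z≤n
  ... | true rewrite f (here refl) eq = ≤-refl

cnt-mono-strict : ∀ {p q : A → Bool} {xs x} → (∀ {x} → x ∈ xs → p x ≡ true → q x ≡ true) →
                  x ∈ xs → p x ≡ false → q x ≡ true → cnt p xs < cnt q xs
cnt-mono-strict {xs = x ∷ xs} f (here refl) px qx rewrite px | qx = s≤s (cnt-mono xs (f ∘ there))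
cnt-mono-strict {p = p} {q} {xs = x ∷ xs} f (there i) px qx with p x in eq
... | false = ≤-trans (cnt-mono-strict (f ∘ there) i px qx) (m≤n+m _ (bit (q x)))
... | true rewrite f (here refl) eq = s≤s (cnt-mono-strict (f ∘ there) i px qx)

cnt-split : ∀ (p : A → Bool) xs → cnt p xs + cnt (not ∘ p) xs ≡ length xs
cnt-split p []       = refl
cnt-split p (x ∷ xs) with p x
... | true  = cong suc (cnt-split p xs)
... | false = trans (+-suc _ _) (cong suc (cnt-split p xs))

cnt-∪ : ∀ {p q r : A → Bool} xs → (∀ {x} → x ∈ xs → p x ≡ true → q x ≡ true ⊎ r x ≡ true) →
        cnt p xs ≤ cnt q xs + cnt r xs
cnt-∪ [] f = z≤n
cnt-∪ {p = p} {q} {r} (x ∷ xs) f with p x in eq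
... | false = ≤-trans (cnt-∪ xs (f ∘ there)) (+-mono-≤ (m≤n+m _ (bit (q x))) (m≤n+m _ (bit (r x))))
... | true with f (here refl) eq
...   | inj₁ qx rewrite qx = s≤s (≤-trans (cnt-∪ xs (f ∘ there)) (+-monoʳ-≤ (cnt q xs) (m≤n+m _ (bit (r x)))))
...   | inj₂ rx rewrite rx = ≤-trans (s≤s (≤-trans (cnt-∪ xs (f ∘ there)) (+-monoˡ-≤ (cnt r xs) (m≤n+m (cnt q xs) (bit (q x))))))
                                     (≤-reflexive (sym (+-suc (bit (q x) + cnt q xs) _)))

cnt-⊎ : ∀ {p q r : A → Bool} xs → (∀ {x} → x ∈ xs → p x ≡ true → r x ≡ true) →
        (∀ {x} → x ∈ xs → q x ≡ true → r x ≡ true) →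
        (∀ {x} → x ∈ xs → p x ≡ true → q x ≡ true → ⊥) → cnt p xs + cnt q xs ≤ cnt r xs
cnt-⊎ [] f g h = z≤n
cnt-⊎ {p = p} {q} {r} (x ∷ xs) f g h with p x in ep | q x in eq
... | true  | true  = ⊥-elim (h (here refl) ep eq)
... | true  | false rewrite f (here refl) ep = s≤s (cnt-⊎ xs (f ∘ there) (g ∘ there) (h ∘ there))
... | false | false = ≤-trans (cnt-⊎ xs (f ∘ there) (g ∘ there) (h ∘ there)) (m≤n+m _ (bit (r x)))
... | false | true  rewrite g (here refl) eq =
  ≤-trans (≤-reflexive (+-suc _ _)) (s≤s (cnt-⊎ xs (f ∘ there) (g ∘ there) (h ∘ there)))

cnt-pos : ∀ {p : A → Bool} xs → 1 ≤ cnt p xs → ∃ λ x → x ∈ xs × p x ≡ true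
cnt-pos {p = p} (x ∷ xs) 1≤ with p x in eq
... | true  = x , here refl , eq
... | false with cnt-pos xs 1≤
...   | y , y∈ , py = y , there y∈ , py

cnt-∈ : ∀ {p : A → Bool} {xs x} → x ∈ xs → p x ≡ true → 1 ≤ cnt p xs
cnt-∈ {p = p} {x ∷ xs} (here refl) px rewrite px = s≤s z≤n
cnt-∈ {p = p} {y ∷ xs} (there i)   px = ≤-trans (cnt-∈ i px) (m≤n+m _ (bit (p y)))

cnt-none : ∀ {p : A → Bool} xs → cnt p xs ≡ 0 → ∀ {x} → x ∈ xs → p x ≡ false
cnt-none {p = p} xs eq {x} x∈ with p x in px
... | false = refl
... | true  = ⊥-elim (1+n≰n (≤-trans (cnt-∈ x∈ px) (≤-reflexive eq)))

cnt-replicate : ∀ (p : A → Bool) k x → cnt p (replicate k x) ≡ k * bit (p x)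
cnt-replicate p zero    x = refl
cnt-replicate p (suc k) x = cong (bit (p x) +_) (cnt-replicate p k x)

length-filterᵇ : ∀ (p : A → Bool) xs → length (filterᵇ p xs) ≡ cnt p xs
length-filterᵇ p [] = refl
length-filterᵇ p (x ∷ xs) with p x
... | true  = cong suc (length-filterᵇ p xs)
... | false = length-filterᵇ p xs

∈-filterᵇ⁻ : ∀ (p : A → Bool) {x} xs → x ∈ filterᵇ p xs → x ∈ xs × p x ≡ true
∈-filterᵇ⁻ p (y ∷ xs) i with p y in eq
... | false = case ∈-filterᵇ⁻ p xs i of λ (j , px) → there j , px
∈-filterᵇ⁻ p (y ∷ xs) (here refl) | true = here refl , eq
∈-filterᵇ⁻ p (y ∷ xs) (there i)   | true = case ∈-filterᵇ⁻ p xs i of λ (j , px) → there j , px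

∈-filterᵇ⁺ : ∀ (p : A → Bool) {x} xs → x ∈ xs → p x ≡ true → x ∈ filterᵇ p xs
∈-filterᵇ⁺ p (y ∷ xs) (here refl) py rewrite py = here refl
∈-filterᵇ⁺ p (y ∷ xs) (there i) py with p y
... | true  = there (∈-filterᵇ⁺ p xs i py)
... | false = ∈-filterᵇ⁺ p xs i py

AllPairs-filterᵇ : ∀ {R : A → A → Set} (p : A → Bool) {xs} → AllPairs R xs → AllPairs R (filterᵇ p xs)
AllPairs-filterᵇ p [] = []
AllPairs-filterᵇ p {x ∷ xs} (rx ∷ rxs) with p x
... | true  = All.tabulate (λ i → All.lookup rx (proj₁ (∈-filterᵇ⁻ p xs i))) ∷ AllPairs-filterᵇ p rxs
... | false = AllPairs-filterᵇ p rxs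

AllPairs-lookup : ∀ {R : A → A → Set} → Symmetric R → ∀ {xs x y} → AllPairs R xs → x ∈ xs → y ∈ xs → x ≢ y → R x y
AllPairs-lookup s (r ∷ rs) (here refl) (here refl) x≢y = ⊥-elim (x≢y refl)
AllPairs-lookup s (r ∷ rs) (here refl) (there j)   x≢y = All.lookup r j
AllPairs-lookup s (r ∷ rs) (there i)   (here refl) x≢y = s (All.lookup r i)
AllPairs-lookup s (r ∷ rs) (there i)   (there j)   x≢y = AllPairs-lookup s rs i j x≢y

AllPairs-tabulate : ∀ {R : A → A → Set} {xs} → Unique xs → (∀ {x y} → x ∈ xs → y ∈ xs → x ≢ y → R x y) → AllPairs R xs
AllPairs-tabulate []       f = []
AllPairs-tabulate (u ∷ us) f =
  All.tabulate (λ i → f (here refl) (there i) (All.lookup u i)) ∷ AllPairs-tabulate us (λ i j → f (there i) (there j))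

cnt-≤1 : ∀ {p : A → Bool} {xs} → Unique xs →
         (∀ {x y} → x ∈ xs → y ∈ xs → p x ≡ true → p y ≡ true → x ≡ y) → cnt p xs ≤ 1
cnt-≤1 [] f = z≤n
cnt-≤1 {p = p} {x ∷ xs} (u ∷ us) f with p x in eq
... | false = cnt-≤1 us (λ i j → f (there i) (there j))
... | true  with cnt p xs in c
...   | zero  = s≤s z≤n
...   | suc _ with cnt-pos xs (≤-trans (s≤s z≤n) (≤-reflexive (sym c)))
...     | y , y∈ , py = ⊥-elim (All.lookup u y∈ (f (here refl) (there y∈) eq py))

-- Entries of `ys` count with multiplicity, so a weighted vertex set can be passed as a list with
-- repetitions.
double-count : ∀ {B : Set} (ρ : A → B → Bool) xs ys c d →
               (∀ {x} → x ∈ xs → c ≤ cnt (ρ x) ys) → (∀ {y} → y ∈ ys → cnt (λ x → ρ x y) xs ≤ d) →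
               c * length xs ≤ length ys * d
double-count {A} {B} ρ xs ys c d lower upper = ≤-trans (below xs lower) (above ys upper)
  where
  total : List A → List B → ℕ
  total []       ys = 0
  total (x ∷ xs) ys = cnt (ρ x) ys + total xs ys
  below : ∀ xs → (∀ {x} → x ∈ xs → c ≤ cnt (ρ x) ys) → c * length xs ≤ total xs ys
  below []       l = ≤-reflexive (*-zeroʳ c)
  below (x ∷ xs) l = ≤-trans (≤-reflexive (*-suc c _)) (+-mono-≤ (l (here refl)) (below xs (l ∘ there)))
  total-[] : ∀ xs → total xs [] ≡ 0
  total-[] []       = refl
  total-[] (x ∷ xs) = total-[] xs
  total-∷ : ∀ xs y ys → total xs (y ∷ ys) ≡ cnt (λ x → ρ x y) xs + total xs ys
  total-∷ []       y ys = refl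
  total-∷ (x ∷ xs) y ys rewrite total-∷ xs y ys = interchange (bit (ρ x y)) _ _ _
  above : ∀ ys → (∀ {y} → y ∈ ys → cnt (λ x → ρ x y) xs ≤ d) → total xs ys ≤ length ys * d
  above []       u = ≤-reflexive (total-[] xs)
  above (y ∷ ys) u = ≤-trans (≤-reflexive (total-∷ xs y ys)) (+-mono-≤ (u (here refl)) (above ys (u ∘ there)))

-- Deciding bounded existential statements

Search : (A → Set) → Set₁
Search {A} Q = ∀ {P : A → Set} → (∀ x → Dec (P x)) → Dec (∃ λ x → Q x × P x)

search-∈ : (xs : List A) → Search (_∈ xs)
search-∈ xs P? = Dec.map′ find (λ (x , x∈ , px) → lose x∈ px) (Any.any? P? xs)

search-lists : ∀ {Q : A → Set} → Search Q → ∀ k → Search (λ xs → length xs ≡ k × All Q xs)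
search-lists search zero {P} P? = Dec.map′ (λ p → [] , (refl , []) , p) from (P? [])
  where
  from : _ → P []
  from ([] , _ , p) = p
search-lists {A} {Q} search (suc k) {P} P? =
  Dec.map′ to from (search (λ x → search-lists search k (λ xs → P? (x ∷ xs))))
  where
  to : _ → _
  to (x , qx , xs , (len , qs) , p) = x ∷ xs , (cong suc len , qx ∷ qs) , p
  from : ∃ (λ xs → (length xs ≡ suc k × All Q xs) × P xs) → _
  from (x ∷ xs , (len , qx ∷ qs) , p) = x , qx , xs , (suc-injective len , qs) , p

-- The Andrásfai–Erdős–Sós theorem, for a reflexive symmetric relation

Rel : Set → Set
Rel A = A → A → Bool

Indep : ∀ {A} → Rel A → List A → Set
Indep ρ = AllPairs (λ u v → ρ u v ≡ false)

NoIndep : ∀ {A} → Rel A → List A → ℕ → Set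
NoIndep ρ W k = ∀ {K} → All (_∈ W) K → Indep ρ K → length K ≢ k

indep-filter-tail : ∀ {A} {ρ : Rel A} (p : A → Bool) U {P} → Indep ρ (U ++ P) → Indep ρ (U ++ filterᵇ p P)
indep-filter-tail p []      i       = AllPairs-filterᵇ p i
indep-filter-tail p (u ∷ U) {P} (r ∷ i) = All.tabulate (All.lookup r ∘ back) ∷ indep-filter-tail p U i
  where
  back : ∀ {x} → x ∈ U ++ filterᵇ p P → x ∈ U ++ P
  back x∈ with ∈-++⁻ U x∈
  ... | inj₁ x∈U = ∈-++⁺ˡ x∈U
  ... | inj₂ x∈P = ∈-++⁺ʳ U (proj₁ (∈-filterᵇ⁻ p P x∈P))

-- The theorem is phrased in the complement. For reflexive `ρ` the count `cnt (ρ u) W` includes `u`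
-- itself, so `large` is the classical condition that the minimum degree exceeds
-- `(3 k - 7) / (3 k - 4)` times the order in a graph without `K_k`, where `k = q + 2`.
module Cherry {A : Set} (ρ : Rel A) (ρ-sym : ∀ u v → ρ u v ≡ ρ v u) (W : List A) (q d : ℕ)
  (noIndep : NoIndep ρ W (suc (suc q)))
  (deg : ∀ {u} → u ∈ W → cnt (ρ u) W ≤ d)
  (large : (3 * q + 2) * d < 3 * length W) where

  -- As in Brandt's proof, U ++ P and U ++ Q are the two independent sets completing the
  -- critical edges xy and xz of a cherry whose end points y and z are not adjacent.
  record Configuration (s : ℕ) : Set where
    constructor conf
    field
      x y z         : A
      U P Q         : List A
      x∈W           : x ∈ W
      y∈W           : y ∈ W
      z∈W           : z ∈ W
      U⊆W           : All (_∈ W) U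
      P⊆W           : All (_∈ W) P
      Q⊆W           : All (_∈ W) Q
      |U|+s         : length U + s ≡ q
      |P|           : length P ≡ s
      |Q|           : length Q ≡ s
      xP            : Indep ρ (x ∷ U ++ P)
      yP            : Indep ρ (y ∷ U ++ P)
      xQ            : Indep ρ (x ∷ U ++ Q)
      zQ            : Indep ρ (z ∷ U ++ Q)
      yz            : ρ y z ≡ false

  -- Otherwise `v` could be added to `K`.
  dominated : ∀ {v K} → v ∈ W → All (_∈ W) K → Indep ρ K → length K ≡ suc q → 1 ≤ cnt (ρ v) K
  dominated {v} {K} v∈ K⊆W ind len with cnt (ρ v) K in eq
  ... | suc _ = s≤s z≤n
  ... | zero  = ⊥-elim (noIndep (v∈ ∷ K⊆W) (All.tabulate (cnt-none K eq) ∷ ind) (cong suc len))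

  -- The first four inequalities come from `dominated`, applied to `U ++ P` with `x` or `y` and to
  -- `U ++ Q` with `x` or `z`. A neighbour in `U` alone weighs 3. Without one, being related to `x`
  -- weighs at least 1, and the sets of `y` and of `z` still have to be met at weight 1 each. So `x`
  -- is missed, and the weight 2 is spent on one vertex of `P` and one of `Q`.
  light : ∀ cU cP cQ s bx by bz →
          1 ≤ bx + (cU + cP) → 1 ≤ by + (cU + cP) → 1 ≤ bx + (cU + cQ) → 1 ≤ bz + (cU + cQ) →
          cU + (cU + (cU + (cP + (cQ + (suc s * bx + (by + (bz + 0))))))) ≤ 2 →
          cU ≡ 0 × cP ≡ 1 × cQ ≡ 1 × bx ≡ 0 × by ≡ 0 × bz ≡ 0
  light (suc cU) cP cQ s bx by bz _ _ _ _ w = ⊥-elim (1+n≰n (linear 3 2 _ w (slack cU cP cQ (suc s * bx + (by + (bz + 0))))))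
    where
    slack : ∀ u p q r → 3 + 2 + (u + (u + (u + (p + (q + r))))) ≡ 2 + (1 + u + (1 + u + (1 + u + (p + (q + r)))))
    slack = solve-∀
  light zero zero cQ s (suc bx) (suc by) bz _ _ _ d₄ w =
    ⊥-elim (1+n≰n (linear 3 2 _ (+-mono-≤ w d₄) (slack cQ s bx by bz)))
    where
    slack : ∀ cQ s bx by bz → 3 + (2 + (bz + cQ)) + (bx + s + s * bx + by) ≡ 2 + (cQ + ((1 + s) * (1 + bx) + (1 + by + (bz + 0))) + 1)
    slack = solve-∀
  light zero zero cQ s (suc bx) zero bz _ () _ _ w
  light zero zero cQ s zero by bz () _ _ _ w
  light zero (suc cP) zero s (suc bx) by (suc bz) _ _ _ _ w = ⊥-elim (1+n≰n (linear 3 2 _ w (slack cP s bx by bz)))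
    where
    slack : ∀ cP s bx by bz → 3 + 2 + (cP + bx + s + s * bx + by + bz) ≡ 2 + (1 + cP + (0 + ((1 + s) * (1 + bx) + (by + (1 + bz + 0)))))
    slack = solve-∀
  light zero (suc cP) zero s zero by bz _ _ () _ w
  light zero (suc cP) zero s (suc bx) by zero _ _ _ () w
  light zero 1 1 s 0 0 0 _ _ _ _ w = refl , refl , refl , refl , refl , refl
  light zero (suc (suc cP)) (suc cQ) s bx by bz _ _ _ _ w = ⊥-elim (1+n≰n (linear 3 2 _ w (slack cP cQ (suc s * bx + (by + (bz + 0))))))
    where
    slack : ∀ p q r → 3 + 2 + (p + (q + r)) ≡ 2 + (2 + p + (1 + q + r))
    slack = solve-∀
  light zero 1 (suc (suc cQ)) s bx by bz _ _ _ _ w = ⊥-elim (1+n≰n (linear 3 2 _ w (slack cQ (suc s * bx + (by + (bz + 0))))))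
    where
    slack : ∀ q r → 3 + 2 + (q + r) ≡ 2 + (1 + (2 + q + r))
    slack = solve-∀
  light zero 1 1 s (suc bx) by bz _ _ _ _ w = ⊥-elim (1+n≰n (linear 3 2 _ w (slack s bx by bz)))
    where
    slack : ∀ s bx by bz → 3 + 2 + (bx + s + s * bx + by + bz) ≡ 2 + (1 + (1 + ((1 + s) * (1 + bx) + (by + (bz + 0)))))
    slack = solve-∀
  light zero 1 1 s zero (suc by) bz _ _ _ _ w = ⊥-elim (1+n≰n (linear 3 2 _ w (slack s by bz)))
    where
    slack : ∀ s by bz → 3 + 2 + (by + bz) ≡ 2 + (1 + (1 + ((1 + s) * 0 + (1 + by + (bz + 0)))))
    slack = solve-∀
  light zero 1 1 s zero zero (suc bz) _ _ _ _ w = ⊥-elim (1+n≰n (linear 3 2 _ w (slack s bz)))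
    where
    slack : ∀ s bz → 3 + 2 + bz ≡ 2 + (1 + (1 + ((1 + s) * 0 + (0 + (1 + bz + 0)))))
    slack = solve-∀

  bit-0 : ∀ {b} → bit b ≡ 0 → b ≡ false
  bit-0 {false} _ = refl

  module Weights {s} (c : Configuration (suc s)) where
    open Configuration c

    -- Brandt's weights: 3 on U, 1 on P, Q, y and z, and |P| on x. A vertex adjacent or equal to weight below 3 can be
    -- moved into U, whereas if there is none, double counting contradicts the degree bound.
    K : List A
    K = U ++ (U ++ (U ++ (P ++ (Q ++ (replicate (suc s) x ++ (y ∷ z ∷ []))))))

    |K| : length K ≡ 3 * q + 2
    |K| rewrite List.length-++ U {U ++ (U ++ (P ++ (Q ++ (replicate (suc s) x ++ (y ∷ z ∷ [])))))}
              | List.length-++ U {U ++ (P ++ (Q ++ (replicate (suc s) x ++ (y ∷ z ∷ []))))}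
              | List.length-++ U {P ++ (Q ++ (replicate (suc s) x ++ (y ∷ z ∷ [])))}
              | List.length-++ P {Q ++ (replicate (suc s) x ++ (y ∷ z ∷ []))}
              | List.length-++ Q {replicate (suc s) x ++ (y ∷ z ∷ [])}
              | List.length-++ (replicate s x) {y ∷ z ∷ []}
              | List.length-replicate s {x} | |P| | |Q| | sym |U|+s = total (length U) (suc s)
      where
      total : ∀ u s → u + (u + (u + (s + (s + (s + 2))))) ≡ 3 * (u + s) + 2
      total = solve-∀

    K⊆W : All (_∈ W) K
    K⊆W = All.++⁺ U⊆W (All.++⁺ U⊆W (All.++⁺ U⊆W (All.++⁺ P⊆W (All.++⁺ Q⊆W
            (All.++⁺ (All.replicate⁺ (suc s) x∈W) (y∈W ∷ z∈W ∷ []))))))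

    weight : ∀ v → cnt (ρ v) K ≡ cnt (ρ v) U + (cnt (ρ v) U + (cnt (ρ v) U + (cnt (ρ v) P + (cnt (ρ v) Q +
                     (suc s * bit (ρ v x) + (bit (ρ v y) + (bit (ρ v z) + 0)))))))
    weight v rewrite cnt-++ (ρ v) U (U ++ (U ++ (P ++ (Q ++ (replicate (suc s) x ++ (y ∷ z ∷ []))))))
              | cnt-++ (ρ v) U (U ++ (P ++ (Q ++ (replicate (suc s) x ++ (y ∷ z ∷ [])))))
              | cnt-++ (ρ v) U (P ++ (Q ++ (replicate (suc s) x ++ (y ∷ z ∷ []))))
              | cnt-++ (ρ v) P (Q ++ (replicate (suc s) x ++ (y ∷ z ∷ [])))
              | cnt-++ (ρ v) Q (replicate (suc s) x ++ (y ∷ z ∷ []))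
              | cnt-++ (ρ v) (replicate (suc s) x) (y ∷ z ∷ [])
              | cnt-replicate (ρ v) (suc s) x = refl

    one-light : ∃ λ v → v ∈ W × cnt (ρ v) K ≤ 2
    one-light with All.all? (λ v → 3 ≤? cnt (ρ v) K) W
    ... | no  ¬heavy = case find (All.¬All⇒Any¬ (λ v → 3 ≤? cnt (ρ v) K) W ¬heavy) of
                       λ (v , v∈ , l) → v , v∈ , ≤-pred (≰⇒> l)
    ... | yes heavy  = ⊥-elim (<⇒≱ large (≤-trans
            (double-count ρ W K 3 d (All.lookup heavy) λ {u} u∈ →
               ≤-trans (cnt-mono W λ {v} _ r → trans (ρ-sym u v) r) (deg (All.lookup K⊆W u∈)))
            (≤-reflexive (cong (_* d) |K|))))

    extend : ∀ {x P v} → Indep ρ (x ∷ U ++ P) → ρ v x ≡ false → cnt (ρ v) U ≡ 0 →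
             Indep ρ (x ∷ v ∷ U ++ filterᵇ (not ∘ ρ v) P)
    extend {x} {P} {v} i vx vU with indep-filter-tail (not ∘ ρ v) (x ∷ U) i
    ... | r ∷ rs = (trans (ρ-sym x v) vx ∷ r) ∷ All.++⁺ (All.tabulate (cnt-none U vU)) (All.tabulate off) ∷ rs
      where
      off : ∀ {p} → p ∈ filterᵇ (not ∘ ρ v) P → ρ v p ≡ false
      off {p} p∈ with ρ v p | proj₂ (∈-filterᵇ⁻ (not ∘ ρ v) P p∈)
      ... | false | _ = refl

    shrink : ∀ v P → length P ≡ suc s → cnt (ρ v) P ≡ 1 → length (filterᵇ (not ∘ ρ v) P) ≡ s
    shrink v P len one = trans (length-filterᵇ (not ∘ ρ v) P)
      (suc-injective (trans (cong (_+ cnt (not ∘ ρ v) P) (sym one)) (trans (cnt-split (ρ v) P) len)))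

    smaller : Configuration s
    smaller with one-light
    ... | v , v∈ , w with light (cnt (ρ v) U) (cnt (ρ v) P) (cnt (ρ v) Q) s (bit (ρ v x)) (bit (ρ v y)) (bit (ρ v z))
                       (dom x∈W P⊆W xP |P|) (dom y∈W P⊆W yP |P|) (dom x∈W Q⊆W xQ |Q|) (dom z∈W Q⊆W zQ |Q|)
                       (subst (_≤ 2) (weight v) w)
      where
      dom : ∀ {a P} → a ∈ W → All (_∈ W) P → Indep ρ (a ∷ U ++ P) → length P ≡ suc s →
            1 ≤ bit (ρ v a) + (cnt (ρ v) U + cnt (ρ v) P)
      dom {a} {P} a∈ P⊆W i |P| = ≤-trans
        (dominated v∈ (a∈ ∷ All.++⁺ U⊆W P⊆W) i (cong suc (trans (List.length-++ U) (trans (cong (length U +_) |P|) |U|+s))))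
        (≤-reflexive (cong (bit (ρ v a) +_) (cnt-++ (ρ v) U P)))
    -- The light vertex joins `U`, while its only neighbour in `P` and its only neighbour in `Q`
    -- leave.
    ... | vU , vP , vQ , vx , vy , vz = record
      { x = x ; y = y ; z = z ; U = v ∷ U ; P = filterᵇ (not ∘ ρ v) P ; Q = filterᵇ (not ∘ ρ v) Q
      ; x∈W = x∈W ; y∈W = y∈W ; z∈W = z∈W ; U⊆W = v∈ ∷ U⊆W
      ; P⊆W = All.tabulate (All.lookup P⊆W ∘ proj₁ ∘ ∈-filterᵇ⁻ (not ∘ ρ v) P)
      ; Q⊆W = All.tabulate (All.lookup Q⊆W ∘ proj₁ ∘ ∈-filterᵇ⁻ (not ∘ ρ v) Q)
      ; |U|+s = trans (sym (+-suc _ _)) |U|+s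
      ; |P| = shrink v P |P| vP ; |Q| = shrink v Q |Q| vQ
      ; xP = extend xP (bit-0 vx) vU ; yP = extend yP (bit-0 vy) vU
      ; xQ = extend xQ (bit-0 vx) vU ; zQ = extend zQ (bit-0 vz) vU
      ; yz = yz }

  -- Once `P` and `Q` are used up, `y`, `z` and `U` form an independent set of `q + 2` vertices.
  no-configuration : ∀ s → ¬ Configuration s
  no-configuration (suc s) c = no-configuration s (Weights.smaller c)
  no-configuration zero (conf x y z U [] [] _ y∈ z∈ U⊆W _ _ |U|+s _ _ _ yP _ zQ yz)
    with subst (Indep ρ ∘ (y ∷_)) (List.++-identityʳ U) yP | subst (Indep ρ ∘ (z ∷_)) (List.++-identityʳ U) zQ
  ... | ry ∷ _ | rz ∷ rs = noIndep (y∈ ∷ z∈ ∷ U⊆W) ((yz ∷ ry) ∷ rz ∷ rs)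
                             (cong (suc ∘ suc) (trans (sym (+-identityʳ _)) |U|+s))

-- Edge deletion, critical edges and colour classes

module _ {A : Set} (_≟_ : DecidableEquality A) where

  isEdge : A → A → A → A → Bool
  isEdge x y u v = (does (u ≟ x) ∧ does (v ≟ y)) ∨ (does (u ≟ y) ∧ does (v ≟ x))

  delete : A → A → Rel A → Rel A
  delete x y ρ u v = ρ u v ∧ not (isEdge x y u v)

  isEdge⁻ : ∀ {x y u v} → isEdge x y u v ≡ true → (u ≡ x × v ≡ y) ⊎ (u ≡ y × v ≡ x)
  isEdge⁻ {x} {y} {u} {v} e with u ≟ x | v ≟ y | u ≟ y | v ≟ x
  ... | yes p | yes q | _     | _     = inj₁ (p , q)
  ... | yes p | no _  | yes q | yes r = inj₂ (q , r)
  ... | no _  | _     | yes q | yes r = inj₂ (q , r)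

  isEdge-refl : ∀ x y → isEdge x y x y ≡ true
  isEdge-refl x y rewrite dec-true (x ≟ x) refl | dec-true (y ≟ y) refl = refl

  isEdge-sym : ∀ x y u v → isEdge x y u v ≡ isEdge x y v u
  isEdge-sym x y u v with does (u ≟ x) | does (v ≟ y) | does (u ≟ y) | does (v ≟ x)
  ... | true  | true  | true  | true  = refl
  ... | true  | true  | true  | false = refl
  ... | true  | true  | false | true  = refl
  ... | true  | true  | false | false = refl
  ... | true  | false | true  | true  = refl
  ... | true  | false | true  | false = refl
  ... | true  | false | false | true  = refl
  ... | true  | false | false | false = refl
  ... | false | true  | true  | true  = refl
  ... | false | true  | true  | false = refl
  ... | false | true  | false | true  = refl
  ... | false | true  | false | false = refl
  ... | false | false | true  | true  = refl
  ... | false | false | true  | false = refl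
  ... | false | false | false | true  = refl
  ... | false | false | false | false = refl

  delete-⊆ : ∀ x y ρ {u v} → delete x y ρ u v ≡ true → ρ u v ≡ true
  delete-⊆ x y ρ {u} {v} e with ρ u v
  ... | true = refl

  delete-sym : ∀ x y (ρ : Rel A) → (∀ u v → ρ u v ≡ ρ v u) → ∀ u v → delete x y ρ u v ≡ delete x y ρ v u
  delete-sym x y ρ s u v = cong₂ (λ a b → a ∧ not b) (s u v) (isEdge-sym x y u v)

  delete-refl : ∀ {x y} → x ≢ y → ∀ (ρ : Rel A) → (∀ u → ρ u u ≡ true) → ∀ u → delete x y ρ u u ≡ true
  delete-refl {x} {y} x≢y ρ r u rewrite r u with isEdge x y u u in e
  ... | false = refl
  ... | true with isEdge⁻ {x} {y} {u} {u} e
  ...   | inj₁ (p , q) = ⊥-elim (x≢y (trans (sym p) q))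
  ...   | inj₂ (p , q) = ⊥-elim (x≢y (trans (sym q) p))

  delete-edge : ∀ x y ρ → delete x y ρ x y ≡ false
  delete-edge x y ρ rewrite isEdge-refl x y with ρ x y
  ... | true  = refl
  ... | false = refl

  delete-other : ∀ {x y ρ u v} → delete x y ρ u v ≡ false → ¬ ((u ≡ x × v ≡ y) ⊎ (u ≡ y × v ≡ x)) → ρ u v ≡ false
  delete-other {x} {y} {ρ} {u} {v} e ne with ρ u v | isEdge x y u v in i
  ... | false | _     = refl
  ... | true  | true  = ⊥-elim (ne (isEdge⁻ i))

  indep-unique : ∀ (ρ : Rel A) → (∀ u → ρ u u ≡ true) → ∀ {K} → Indep ρ K → Unique K
  indep-unique ρ r = AllPairs.map λ { e refl → false≢true e (r _) }

  ColouringOf : Rel A → List A → ℕ → Set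
  ColouringOf ρ W r = ∃ λ (f : A → ℕ) → (∀ {v} → v ∈ W → f v < r) ×
    (∀ {u v} → u ∈ W → v ∈ W → f u ≡ f v → ρ u v ≡ true)

  -- On `W` the relation is an equivalence, and representatives of its classes are independent, so
  -- there are at most `r` classes. The class of the first vertex receives the highest colour;
  -- outside it the bound on independent sets drops by one.
  colour-classes : ∀ {ρ : Rel A} → (∀ u v → ρ u v ≡ ρ v u) → ∀ r W →
    (∀ {x y z} → x ∈ W → y ∈ W → z ∈ W → ρ x y ≡ true → ρ x z ≡ true → ρ y z ≡ true) →
    (∀ {x} → x ∈ W → ρ x x ≡ true) →
    NoIndep ρ W (suc r) → ColouringOf ρ W r
  colour-classes s r [] t rf none = (λ _ → 0) , (λ ()) , λ ()
  colour-classes s zero (x ∷ W) t rf none = ⊥-elim (none (here refl ∷ []) ([] ∷ []) refl)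
  colour-classes {ρ} s (suc r) W@(x ∷ _) t rf none with colour-classes s r (filterᵇ (not ∘ ρ x) W)
      (λ a b c → t (⊆W a) (⊆W b) (⊆W c)) (rf ∘ ⊆W)
      (λ {K} K⊆ ind len → none (here refl ∷ All.map ⊆W K⊆) (All.map off K⊆ ∷ ind) (cong suc len))
    where
    ⊆W : ∀ {v} → v ∈ filterᵇ (not ∘ ρ x) W → v ∈ W
    ⊆W = proj₁ ∘ ∈-filterᵇ⁻ (not ∘ ρ x) W
    off : ∀ {v} → v ∈ filterᵇ (not ∘ ρ x) W → ρ x v ≡ false
    off {v} v∈ with ρ x v | proj₂ (∈-filterᵇ⁻ (not ∘ ρ x) W v∈)
    ... | false | _ = refl
  ... | f , f< , same = g , g< , g-same
    where
    g : A → ℕ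
    g v = if ρ x v then r else f v
    rest : ∀ {v} → v ∈ W → ρ x v ≡ false → v ∈ filterᵇ (not ∘ ρ x) W
    rest v∈ e = ∈-filterᵇ⁺ (not ∘ ρ x) W v∈ (cong not e)
    g< : ∀ {v} → v ∈ W → g v < suc r
    g< {v} v∈ with ρ x v in e
    ... | true  = ≤-refl
    ... | false = m≤n⇒m≤1+n (f< (rest v∈ e))
    g-same : ∀ {u v} → u ∈ W → v ∈ W → g u ≡ g v → ρ u v ≡ true
    g-same {u} {v} u∈ v∈ eq with ρ x u in eu | ρ x v in ev
    ... | true  | true  = t (here refl) u∈ v∈ eu ev
    ... | true  | false = ⊥-elim (<-irrefl (sym eq) (f< (rest v∈ ev)))
    ... | false | true  = ⊥-elim (<-irrefl eq (f< (rest u∈ eu)))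
    ... | false | false = same (rest u∈ eu) (rest v∈ ev) eq

  indep? : ∀ (ρ : Rel A) K → Dec (Indep ρ K)
  indep? ρ = AllPairs.allPairs? (λ u v → ρ u v Bool.≟ false)

  IndepSet : Rel A → List A → ℕ → Set
  IndepSet ρ W k = ∃ λ K → (length K ≡ k × All (_∈ W) K) × Indep ρ K

  indepSet? : ∀ ρ W k → Dec (IndepSet ρ W k)
  indepSet? ρ W k = search-lists (search-∈ W) k (indep? ρ)

  Critical : Rel A → List A → ℕ → A → A → Set
  Critical ρ W q x y = ∃ λ P → length P ≡ q × All (_∈ W) P × Indep ρ (x ∷ P) × Indep ρ (y ∷ P)

  module _ {ρ : Rel A} (ρ-refl : ∀ u → ρ u u ≡ true) (ρ-sym : ∀ u v → ρ u v ≡ ρ v u)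
    {W : List A} {q : ℕ} (none : NoIndep ρ W (suc (suc q))) where

    -- An independent set created by deleting the edge `x y` contains both ends, since otherwise it
    -- was independent before.
    critical : ∀ {x y} → x ≢ y → IndepSet (delete x y ρ) W (suc (suc q)) → Critical ρ W q x y
    critical {x} {y} x≢y (K , (len , K⊆W) , ind) = P , |P| , All.tabulate (All.lookup K⊆W ∘ P⊆K) ,
      indep x∈K (inj₁ refl) , indep y∈K (inj₂ refl)
      where
      K! : Unique K
      K! = indep-unique (delete x y ρ) (delete-refl x≢y ρ ρ-refl) ind
      ρ-false : ∀ {u v} → u ∈ K → v ∈ K → u ≢ v → ¬ ((u ≡ x × v ≡ y) ⊎ (u ≡ y × v ≡ x)) → ρ u v ≡ false
      ρ-false u∈ v∈ u≢v = delete-other {ρ = ρ} (AllPairs-lookup (λ {u} {v} e → trans (delete-sym x y ρ ρ-sym v u) e) ind u∈ v∈ u≢v)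
      member : ∀ w → (∀ {u v} → u ≢ w → v ≢ w → ¬ ((u ≡ x × v ≡ y) ⊎ (u ≡ y × v ≡ x))) → w ∈ K
      member w ne with Any.any? (w ≟_) K
      ... | yes w∈ = w∈
      ... | no  w∉ = ⊥-elim (none K⊆W (AllPairs-tabulate K! λ u∈ v∈ u≢v →
                       ρ-false u∈ v∈ u≢v (ne (λ { refl → w∉ u∈ }) (λ { refl → w∉ v∈ }))) len)
      x∈K : x ∈ K
      x∈K = member x λ { u≢ v≢ (inj₁ (p , _)) → u≢ p ; u≢ v≢ (inj₂ (_ , p)) → v≢ p }
      y∈K : y ∈ K
      y∈K = member y λ { u≢ v≢ (inj₁ (_ , p)) → v≢ p ; u≢ v≢ (inj₂ (p , _)) → u≢ p }
      end : A → Bool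
      end v = does (v ≟ x) ∨ does (v ≟ y)
      P₀ = filterᵇ (not ∘ end) K
      -- Only the bound that at most two entries of `K` are ends is proved; truncation then gives
      -- the exact length.
      P = take q P₀
      P₀-long : q ≤ length P₀
      P₀-long = linear q (length P₀) 0 (≤-trans (cnt-∪ {p = end} {λ v → does (v ≟ x)} {λ v → does (v ≟ y)} K split)
                  (+-mono-≤ (one x) (one y))) (trans arith (cong₂ _+_ (sym (length-filterᵇ (not ∘ end) K)) refl))
        where
        split : ∀ {v} → v ∈ K → end v ≡ true → does (v ≟ x) ≡ true ⊎ does (v ≟ y) ≡ true
        split {v} _ e with does (v ≟ x)
        ... | true  = inj₁ refl
        ... | false = inj₂ e
        one : ∀ w → cnt (λ v → does (v ≟ w)) K ≤ 1
        one w = cnt-≤1 K! λ {u} {v} _ _ → eq u v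
          where
          eq : ∀ u v → does (u ≟ w) ≡ true → does (v ≟ w) ≡ true → u ≡ v
          eq u v p r with u ≟ w | v ≟ w
          ... | yes refl | yes refl = refl
        arith : q + 2 + 0 ≡ cnt (not ∘ end) K + cnt end K
        arith = trans (trans (+-identityʳ _) (+-comm q 2)) (trans (sym len) (trans (sym (cnt-split end K)) (+-comm (cnt end K) _)))
      |P| : length P ≡ q
      |P| = trans (List.length-take q P₀) (m≤n⇒m⊓n≡m P₀-long)
      take⊆ : ∀ k {xs : List A} {v} → v ∈ take k xs → v ∈ xs
      take⊆ (suc k) {x ∷ xs} (here p)  = here p
      take⊆ (suc k) {x ∷ xs} (there p) = there (take⊆ k p)
      P⊆K : ∀ {v} → v ∈ P → v ∈ K
      P⊆K = proj₁ ∘ ∈-filterᵇ⁻ (not ∘ end) K ∘ take⊆ q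
      not-end : ∀ {v} → v ∈ P → v ≢ x × v ≢ y
      not-end {v} v∈ with v ≟ x | v ≟ y | proj₂ (∈-filterᵇ⁻ (not ∘ end) K (take⊆ q v∈))
      ... | no p | no r | _ = p , r
      indep : ∀ {w} → w ∈ K → w ≡ x ⊎ w ≡ y → Indep ρ (w ∷ P)
      indep {w} w∈ w-end =
        All.tabulate (λ v∈ → ρ-false w∈ (P⊆K v∈) (apart v∈) (avoid v∈)) ∷
        AllPairs-tabulate (AllPairs.take⁺ q (AllPairs-filterᵇ (not ∘ end) K!))
          (λ u∈ v∈ u≢v → ρ-false (P⊆K u∈) (P⊆K v∈) u≢v (avoid v∈))
        where
        avoid : ∀ {u v} → v ∈ P → ¬ ((u ≡ x × v ≡ y) ⊎ (u ≡ y × v ≡ x))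
        avoid v∈ (inj₁ (_ , p)) = proj₂ (not-end v∈) p
        avoid v∈ (inj₂ (_ , p)) = proj₁ (not-end v∈) p
        apart : ∀ {v} → v ∈ P → w ≢ v
        apart v∈ refl = [ proj₁ (not-end v∈) , proj₂ (not-end v∈) ]′ w-end

  -- Counts ordered pairs, loops included; it is the measure that decreases when an edge is deleted.
  edges : Rel A → List A → List A → ℕ
  edges ρ []       W = 0
  edges ρ (x ∷ xs) W = cnt (ρ x) W + edges ρ xs W

  edges-mono : ∀ {ρ′ ρ : Rel A} → (∀ {u v} → ρ′ u v ≡ true → ρ u v ≡ true) → ∀ xs W → edges ρ′ xs W ≤ edges ρ xs W
  edges-mono f []       W = z≤n
  edges-mono f (x ∷ xs) W = +-mono-≤ (cnt-mono W (λ _ → f)) (edges-mono f xs W)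

  edges-mono-strict : ∀ {ρ′ ρ : Rel A} → (∀ {u v} → ρ′ u v ≡ true → ρ u v ≡ true) → ∀ {x y xs W} → x ∈ xs → y ∈ W →
                      ρ′ x y ≡ false → ρ x y ≡ true → edges ρ′ xs W < edges ρ xs W
  edges-mono-strict f {xs = x ∷ xs} {W} (here refl) y∈ e e′ = +-mono-<-≤ (cnt-mono-strict (λ _ → f) y∈ e e′) (edges-mono f xs W)
  edges-mono-strict f {xs = x ∷ xs} {W} (there i)   y∈ e e′ = +-mono-≤-< (cnt-mono W (λ _ → f)) (edges-mono-strict f i y∈ e e′)

  -- Non-critical edges are deleted until every remaining edge is critical; the surviving relation is then transitive on W.
  andrásfai-erdős-sós : ∀ {W : List A} {q d} → (3 * q + 2) * d < 3 * length W →
    ∀ fuel (ρ : Rel A) → edges ρ W W ≤ fuel → (∀ u → ρ u u ≡ true) → (∀ u v → ρ u v ≡ ρ v u) →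
    NoIndep ρ W (suc (suc q)) → (∀ {u} → u ∈ W → cnt (ρ u) W ≤ d) → ColouringOf ρ W (suc q)
  andrásfai-erdős-sós {W} {q} {d} large fuel ρ ≤fuel ρ-refl ρ-sym none deg
    with Any.any? (λ x → Any.any? (λ y → deletable? x y) W) W
    where
    Deletable : A → A → Set
    Deletable x y = x ≢ y × ρ x y ≡ true × ¬ IndepSet (delete x y ρ) W (suc (suc q))
    deletable? : ∀ x y → Dec (Deletable x y)
    deletable? x y = ¬? (x ≟ y) ×-dec (ρ x y Bool.≟ true) ×-dec ¬? (indepSet? (delete x y ρ) W (suc (suc q)))
  ... | no ¬del = colour-classes ρ-sym (suc q) W transitive (λ _ → ρ-refl _) none
    where
    crit : ∀ {x y} → x ∈ W → y ∈ W → x ≢ y → ρ x y ≡ true → Critical ρ W q x y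
    crit {x} {y} x∈ y∈ x≢y e with indepSet? (delete x y ρ) W (suc (suc q))
    ... | yes i = critical ρ-refl ρ-sym none x≢y i
    ... | no ¬i = ⊥-elim (¬del (lose x∈ (lose y∈ (x≢y , e , ¬i))))
    transitive : ∀ {x y z} → x ∈ W → y ∈ W → z ∈ W → ρ x y ≡ true → ρ x z ≡ true → ρ y z ≡ true
    transitive {x} {y} {z} x∈ y∈ z∈ xy xz with x ≟ y | x ≟ z | bool-cases (ρ y z)
    ... | yes refl | _        | _       = xz
    ... | no _     | yes refl | _       = trans (ρ-sym y z) xy
    ... | no _     | no _     | inj₁ yz = yz
    ... | no x≢y   | no x≢z   | inj₂ yz with crit x∈ y∈ x≢y xy | crit x∈ z∈ x≢z xz
    ...   | P , |P| , P⊆W , xP , yP | Q , |Q| , Q⊆W , xQ , zQ =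
      ⊥-elim (Cherry.no-configuration ρ ρ-sym W q d none deg large q
        (Cherry.conf x y z [] P Q x∈ y∈ z∈ [] P⊆W Q⊆W refl |P| |Q| xP yP xQ zQ yz))
  ... | yes del with find del
  ...   | x , x∈ , del′ with find del′
  ...     | y , y∈ , x≢y , xy , ¬i with fuel
  ...       | zero = ⊥-elim (<⇒≱ (edges-mono-strict (delete-⊆ x y ρ) x∈ y∈ (delete-edge x y ρ) xy) (≤-trans ≤fuel z≤n))
  ...       | suc fuel′ with andrásfai-erdős-sós large fuel′ (delete x y ρ)
                (≤-pred (≤-trans (edges-mono-strict (delete-⊆ x y ρ) x∈ y∈ (delete-edge x y ρ) xy) ≤fuel))
                (delete-refl x≢y ρ ρ-refl) (delete-sym x y ρ ρ-sym)
                (λ K⊆ ind len → ¬i (_ , (len , K⊆) , ind))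
                (λ {u} u∈ → ≤-trans (cnt-mono W (λ _ → delete-⊆ x y ρ)) (deg u∈))
  ...         | f , f< , same = f , f< , λ u∈ v∈ eq → delete-⊆ x y ρ (same u∈ v∈ eq)

-- Fans and matchings in a colouring

Unique-resp-↭ : ∀ {xs ys : List A} → xs ↭ ys → Unique xs → Unique ys
Unique-resp-↭ p = ↭ₛ.Unique-resp-↭ (setoid _) (↭⇒↭ₛ p)

pick : ∀ {x : A} {xs} → x ∈ xs → ∃ λ ys → xs ↭ x ∷ ys
pick {xs = x ∷ xs} (here refl) = xs , ↭-refl
pick {xs = y ∷ xs} (there i) with pick i
... | ys , p = y ∷ ys , ↭-trans (prep y p) (swap y _ ↭-refl)

cnt-↭ : ∀ (p : A → Bool) {xs ys} → xs ↭ ys → cnt p xs ≡ cnt p ys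
cnt-↭ p _↭_.refl = refl
cnt-↭ p (prep x q) = cong (bit (p x) +_) (cnt-↭ p q)
cnt-↭ p (swap x y q) rewrite cnt-↭ p q = x∙yz≈y∙xz (bit (p x)) (bit (p y)) _
cnt-↭ p (_↭_.trans q r) = trans (cnt-↭ p q) (cnt-↭ p r)

AllPairs-lookupAt : ∀ {R : A → A → Set} → Symmetric R → ∀ {xs} → AllPairs R xs →
                    ∀ {i j} → i ≢ j → R (lookup xs i) (lookup xs j)
AllPairs-lookupAt s (r ∷ rs) {Fin.zero}  {Fin.zero}  i≢j = ⊥-elim (i≢j refl)
AllPairs-lookupAt s (r ∷ rs) {Fin.zero}  {Fin.suc j} i≢j = All.lookup r (∈-lookup j)
AllPairs-lookupAt s (r ∷ rs) {Fin.suc i} {Fin.zero}  i≢j = s (All.lookup r (∈-lookup i))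
AllPairs-lookupAt s (r ∷ rs) {Fin.suc i} {Fin.suc j} i≢j = AllPairs-lookupAt s rs (i≢j ∘ cong Fin.suc)

_#_ : List A → List A → Set
xs # ys = All (_∉ ys) xs

#-sym : Symmetric (_#_ {A})
#-sym {A} {xs} {ys} d = All.tabulate λ y∈ys y∈xs → All.lookup d y∈xs y∈ys

unique-++ : ∀ {xs ys : List A} → Unique (xs ++ ys) → Unique xs × Unique ys × xs # ys
unique-++ {xs = []}     u       = [] , u , []
unique-++ {xs = x ∷ xs} (r ∷ u) with unique-++ {xs = xs} u
... | uxs , uys , d = All.++⁻ˡ xs r ∷ uxs , uys , (λ x∈ → All.lookup (All.++⁻ʳ xs r) x∈ refl) ∷ d

module _ {N : ℕ} (c : Colouring N) where

  -- A colouring also assigns a meaningless colour to each diagonal pair, so equality is excluded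
  -- explicitly.
  adj : Bool → Rel (Fin N)
  adj b u v = not (does (u ≟ᶠ v)) ∧ does (col c u v Bool.≟ b)

  E : Bool → Fin N → Fin N → Set
  E b u v = adj b u v ≡ true

  adj-sym : ∀ b u v → adj b u v ≡ adj b v u
  adj-sym b u v = cong₂ (λ p q → not p ∧ does (q Bool.≟ b)) (flip u v) (Colouring.sym c u v)
    where
    flip : ∀ u v → does (u ≟ᶠ v) ≡ does (v ≟ᶠ u)
    flip u v with u ≟ᶠ v | v ≟ᶠ u
    ... | yes _ | yes _ = refl
    ... | no _  | no _  = refl
    ... | yes p | no q  = ⊥-elim (q (sym p))
    ... | no p  | yes q = ⊥-elim (p (sym q))

  E-sym : ∀ {b} → Symmetric (E b)
  E-sym {b} {u} {v} e = trans (adj-sym b v u) e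

  adj-irrefl : ∀ b u → adj b u u ≡ false
  adj-irrefl b u rewrite dec-true (u ≟ᶠ u) refl = refl

  E⇒≢ : ∀ {b u v} → E b u v → u ≢ v
  E⇒≢ {b} {u} e refl = false≢true (adj-irrefl b u) e

  E⇒col : ∀ {b u v} → E b u v → col c u v ≡ b
  E⇒col {b} {u} {v} e with u ≟ᶠ v | col c u v Bool.≟ b
  ... | no _ | yes p = p

  colour-of : ∀ {u v} → u ≢ v → E (col c u v) u v
  colour-of {u} {v} u≢v rewrite dec-false (u ≟ᶠ v) u≢v | dec-true (col c u v Bool.≟ col c u v) refl = refl

  adj-other : ∀ b {u v} → u ≢ v → adj b u v ≡ false → E (not b) u v
  adj-other b {u} {v} u≢v e = subst (λ d → E d u v)
    (¬-not λ eq → false≢true e (subst (λ d → E d u v) eq (colour-of u≢v))) (colour-of u≢v)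

  Clique : Bool → List (Fin N) → Set
  Clique b = AllPairs (E b)

  clique-unique : ∀ {b K} → Clique b K → Unique K
  clique-unique = AllPairs.map E⇒≢

  -- The conjuncts are nested so that `search-lists`, applied twice, decides the existence of a
  -- packing. Hence the proof may argue constructively from the absence of a red fan.
  Packing : Bool → ℕ → List (Fin N) → ℕ → Set
  Packing b k S n = ∃ λ Ks → (length Ks ≡ n × All (λ K → length K ≡ k × All (_∈ S) K) Ks) ×
                             (All (Clique b) Ks × AllPairs _#_ Ks)

  nbhd : Bool → Fin N → List (Fin N)
  nbhd b v = filterᵇ (adj b v) (allFin N)

  ∈-nbhd⁺ : ∀ b {v w} → E b v w → w ∈ nbhd b v
  ∈-nbhd⁺ b {v} {w} = ∈-filterᵇ⁺ (adj b v) (allFin N) (∈-allFin w)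

  ∈-nbhd⁻ : ∀ b {v w} → w ∈ nbhd b v → E b v w
  ∈-nbhd⁻ b {v} = proj₂ ∘ ∈-filterᵇ⁻ (adj b v) (allFin N)

  FanIn : Bool → ℕ → ℕ → Set
  FanIn b k n = ∃ λ v → Packing b k (nbhd b v) n

  packing-⊆ : ∀ {b k S T n} → (∀ {v} → v ∈ S → v ∈ T) → Packing b k S n → Packing b k T n
  packing-⊆ f (Ks , (len , sizes) , rest) = Ks , (len , All.map (λ (l , s) → l , All.map f s) sizes) , rest

  fan-at : ∀ {b k S n v} → (∀ {w} → w ∈ S → E b v w) → Packing b k S n → FanIn b k n
  fan-at {b} {v = v} f p = v , packing-⊆ (∈-nbhd⁺ b ∘ f) p

  fan-copy : ∀ {b k n} → FanIn b k n → MonoCopy c b (GenFan k n)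
  fan-copy {b} {k} (v , Ks , (refl , sizes) , cliques , disjoint) = f , injective , coloured
    where
    size : ∀ i → length (lookup Ks i) ≡ k
    size i = proj₁ (All.lookup sizes (∈-lookup i))
    pos : ∀ i → Fin k → Fin (length (lookup Ks i))
    pos i = cast (sym (size i))
    f : Maybe (Fin (length Ks) × Fin k) → Fin N
    f nothing        = v
    f (just (i , a)) = lookup (lookup Ks i) (pos i a)
    f∈ : ∀ i a → f (just (i , a)) ∈ lookup Ks i
    f∈ i a = ∈-lookup (pos i a)
    spoke : ∀ i a → E b v (f (just (i , a)))
    spoke i a = ∈-nbhd⁻ b (All.lookup (proj₂ (All.lookup sizes (∈-lookup i))) (f∈ i a))
    pos-injective : ∀ i {a a′} → pos i a ≡ pos i a′ → a ≡ a′
    pos-injective i {a} {a′} e = Fin.toℕ-injective (trans (sym (Fin.toℕ-cast _ a)) (trans (cong toℕ e) (Fin.toℕ-cast _ a′)))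
    within : ∀ i {a a′} → a ≢ a′ → E b (f (just (i , a))) (f (just (i , a′)))
    within i a≢a′ = AllPairs-lookupAt E-sym (All.lookup cliques (∈-lookup i)) (a≢a′ ∘ pos-injective i)
    injective : ∀ {u w} → f u ≡ f w → u ≡ w
    injective {nothing}      {nothing}      e = refl
    injective {nothing}      {just (j , a)} e = ⊥-elim (E⇒≢ (spoke j a) e)
    injective {just (i , a)} {nothing}      e = ⊥-elim (E⇒≢ (spoke i a) (sym e))
    injective {just (i , a)} {just (j , a′)} e with i ≟ᶠ j
    ... | no i≢j = ⊥-elim (All.lookup (AllPairs-lookupAt #-sym disjoint i≢j) (f∈ i a) (subst (_∈ lookup Ks j) (sym e) (f∈ j a′)))
    ... | yes refl with a ≟ᶠ a′
    ...   | yes refl = refl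
    ...   | no a≢a′  = ⊥-elim (E⇒≢ (within i a≢a′) e)
    coloured : ∀ u w → fanAdj k (length Ks) u w → col c (f u) (f w) ≡ b
    coloured nothing        (just (i , a))  _           = E⇒col (spoke i a)
    coloured (just (i , a)) nothing         _           = E⇒col (E-sym (spoke i a))
    coloured (just (i , a)) (just (.i , a′)) (refl , ne) = E⇒col (within i ne)

  fan? : ∀ b k n → Dec (FanIn b k n)
  fan? b k n = Dec.map′ (λ (v , _ , p) → v , p) (λ (v , p) → v , ∈-allFin v , p)
    (search-∈ (allFin N) λ v → search-lists (search-lists (search-∈ (nbhd b v)) k) n λ Ks →
      All.all? (AllPairs.allPairs? (λ u v → adj b u v Bool.≟ true)) Ks ×-dec
      AllPairs.allPairs? (λ K L → All.all? (λ x → ¬? (Any.any? (x ≟ᶠ_) L)) K) Ks)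

  -- Augmenting a matching

  flat : List (Fin N × Fin N) → List (Fin N)
  flat []             = []
  flat ((x , y) ∷ Ms) = x ∷ y ∷ flat Ms

  length-flat : ∀ Ms → length (flat Ms) ≡ 2 * length Ms
  length-flat []       = refl
  length-flat (_ ∷ Ms) rewrite length-flat Ms = sym (*-suc 2 (length Ms))

  matching-packing : ∀ {b S Ms} → All (λ (x , y) → E b x y) Ms → Unique (flat Ms) → All (_∈ S) (flat Ms) →
                     Packing b 2 S (length Ms)
  matching-packing {b} {S} {[]} [] u s = [] , (refl , []) , [] , []
  matching-packing {b} {S} {(x , y) ∷ Ms} (e ∷ es) ((x≢y ∷ x∉) ∷ (y∉ ∷ u)) (x∈ ∷ y∈ ∷ s)
    with matching-packing {b} {flat Ms} es u (All.tabulate id)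
  ... | Ks , (len , sizes) , cliques , disjoint =
    (x ∷ y ∷ []) ∷ Ks ,
    (cong suc len , (refl , x∈ ∷ y∈ ∷ []) ∷ All.map (λ (l , K⊆) → l , All.map (All.lookup s) K⊆) sizes) ,
    ((e ∷ []) ∷ [] ∷ []) ∷ cliques ,
    All.map (λ (_ , K⊆) → (λ x∈K → All.lookup x∉ (All.lookup K⊆ x∈K) refl) ∷
                          (λ y∈K → All.lookup y∉ (All.lookup K⊆ y∈K) refl) ∷ []) sizes ∷ disjoint

  edge-or-clique : ∀ b {U} → Unique U → (∃₂ λ u w → ∃ λ U′ → U ↭ u ∷ w ∷ U′ × E b u w) ⊎ Clique (not b) U
  edge-or-clique b [] = inj₂ []
  edge-or-clique b {x ∷ U} (x∉ ∷ u) with Any.any? (λ y → adj b x y Bool.≟ true) U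
  ... | yes a with find a
  ...   | y , y∈ , e with pick y∈
  ...     | U′ , p = inj₁ (x , y , U′ , prep x p , e)
  edge-or-clique b {x ∷ U} (x∉ ∷ u) | no ¬a with edge-or-clique b u
  ... | inj₁ (u , w , U′ , p , e) =
    inj₁ (u , w , x ∷ U′ , ↭-trans (prep x p) (↭-trans (swap x u ↭-refl) (prep u (swap x w ↭-refl))) , e)
  ... | inj₂ clique = inj₂ (All.tabulate (λ {y} y∈ → adj-other b (All.lookup x∉ y∈) (nonadjacent y∈)) ∷ clique)
    where
    nonadjacent : ∀ {y} → y ∈ U → adj b x y ≡ false
    nonadjacent {y} y∈ with adj b x y in e
    ... | false = refl
    ... | true  = ⊥-elim (¬a (lose y∈ e))

  -- The list `xs` keeps one end of each matching edge and the other ends are dropped, whence the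
  -- factor 2; `U` is the set of unmatched vertices.
  Stuck : Bool → List (Fin N) → ℕ → Set
  Stuck b L k = ∃₂ λ xs U → length xs < k × length U + 2 * length xs ≡ length L × Clique (not b) U ×
    All (λ x → cnt (adj b x) U ≤ 1) xs × Unique (xs ++ U) × All (_∈ L) (xs ++ U)

  -- If both ends of a matching edge see two vertices of U, the edge can be replaced by two edges into U.
  Augmentable : Bool → List (Fin N) → List (Fin N × Fin N) → Set
  Augmentable b U Ms = ∃₂ λ x y → ∃ λ Ms′ → flat Ms ↭ x ∷ y ∷ flat Ms′ × length Ms ≡ suc (length Ms′) ×
    All (λ (x , y) → E b x y) Ms′ × 2 ≤ cnt (adj b x) U × 2 ≤ cnt (adj b y) U

  exchange-pairs : ∀ (a b u w : Fin N) L → u ∷ w ∷ a ∷ b ∷ L ↭ a ∷ b ∷ u ∷ w ∷ L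
  exchange-pairs a b u w L = ++⁺ʳ L (++-comm (u ∷ w ∷ []) (a ∷ b ∷ []))

  augmentable-or-ends : ∀ b U Ms → All (λ (x , y) → E b x y) Ms → Augmentable b U Ms ⊎
    (∃₂ λ xs ys → length xs ≡ length Ms × flat Ms ↭ ys ++ xs × All (λ x → cnt (adj b x) U ≤ 1) xs)
  augmentable-or-ends b U [] [] = inj₂ ([] , [] , refl , ↭-refl , [])
  augmentable-or-ends b U ((x , y) ∷ Ms) (e ∷ es) with cnt (adj b x) U ≤? 1 | cnt (adj b y) U ≤? 1
  ... | no 1<x | no 1<y = inj₁ (x , y , Ms , ↭-refl , refl , es , ≰⇒> 1<x , ≰⇒> 1<y)
  ... | yes x≤1 | _ with augmentable-or-ends b U Ms es
  ...   | inj₁ (u , w , Ms′ , p , len , es′ , u2 , w2) =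
    inj₁ (u , w , (x , y) ∷ Ms′ ,
      ↭-trans (prep x (prep y p)) (↭-sym (exchange-pairs x y u w _)) , cong suc len , e ∷ es′ , u2 , w2)
  ...   | inj₂ (xs , ys , len , p , few) =
    inj₂ (x ∷ xs , y ∷ ys , cong suc len ,
      ↭-trans (prep x (prep y p)) (↭-trans (swap x y ↭-refl) (prep y (↭-sym (shift x ys xs)))) , x≤1 ∷ few)
  augmentable-or-ends b U ((x , y) ∷ Ms) (e ∷ es) | no _ | yes y≤1 with augmentable-or-ends b U Ms es
  ...   | inj₁ (u , w , Ms′ , p , len , es′ , u2 , w2) =
    inj₁ (u , w , (x , y) ∷ Ms′ ,
      ↭-trans (prep x (prep y p)) (↭-sym (exchange-pairs x y u w _)) , cong suc len , e ∷ es′ , u2 , w2)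
  ...   | inj₂ (xs , ys , len , p , few) =
    inj₂ (y ∷ xs , x ∷ ys , cong suc len ,
      prep x (↭-trans (prep y p) (↭-sym (shift y ys xs))) , y≤1 ∷ few)

  matching-or-stuck : ∀ b {L} → Unique L → ∀ k → Packing b 2 L k ⊎ Stuck b L k
  matching-or-stuck b {L} L! k = loop k [] L (+-identityʳ k) [] ↭-refl
    where
    -- Here `fuel` is the exact number of missing edges: every round gains one, and running out
    -- means success.
    loop : ∀ fuel Ms U → fuel + length Ms ≡ k → All (λ (x , y) → E b x y) Ms → flat Ms ++ U ↭ L →
           Packing b 2 L k ⊎ Stuck b L k
    loop zero Ms U refl es p = inj₁ (matching-packing es (proj₁ (unique-++ (Unique-resp-↭ (↭-sym p) L!)))
      (All.tabulate (∈-resp-↭ p ∘ ∈-++⁺ˡ)))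
    loop (suc fuel) Ms U len es p with edge-or-clique b (proj₁ (proj₂ (unique-++ {xs = flat Ms} (Unique-resp-↭ (↭-sym p) L!))))
    ... | inj₁ (u , w , U′ , q , e) = loop fuel ((u , w) ∷ Ms) U′ (trans (+-suc fuel _) len) (e ∷ es)
      (↭-trans (↭-sym (↭-trans (shift u (flat Ms) (w ∷ U′)) (prep u (shift w (flat Ms) U′))))
        (↭-trans (++⁺ˡ (flat Ms) (↭-sym q)) p))
    ... | inj₂ clique with augmentable-or-ends b U Ms es
    ...   | inj₂ (xs , ys , lx , q , few) = inj₂ (xs , U , short , size , clique , few ,
              proj₁ (proj₂ (unique-++ {xs = ys} (Unique-resp-↭ (↭-sym L↭) L!))) ,
              All.tabulate (∈-resp-↭ L↭ ∘ ∈-++⁺ʳ ys))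
      where
      L↭ : ys ++ (xs ++ U) ↭ L
      L↭ = ↭-trans (subst (_↭ flat Ms ++ U) (List.++-assoc ys xs U) (++⁺ʳ U (↭-sym q))) p
      short : length xs < k
      short = ≤-trans (s≤s (≤-trans (≤-reflexive lx) (m≤n+m _ fuel))) (≤-reflexive len)
      size : length U + 2 * length xs ≡ length L
      size = trans (+-comm (length U) _) (trans (cong (_+ length U) (trans (cong (2 *_) lx) (sym (length-flat Ms))))
               (trans (sym (List.length-++ (flat Ms))) (↭-length p)))
    ...   | inj₁ (x , y , Ms′ , q , lm , es′ , x2 , y2) with cnt-pos U (≤-trans (s≤s z≤n) x2)
    ...     | u , u∈ , xu with pick u∈
    -- Since `y` sees two vertices of `U`, one is left after `u` is given to `x`.
    ...       | U₁ , q₁ with cnt-pos {p = adj b y} U₁ (≤-pred (≤-trans y2 (≤-trans (≤-reflexive (cnt-↭ (adj b y) q₁)) (+-monoˡ-≤ _ (bit≤1 (adj b y u))))))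
    ...         | w , w∈ , yw with pick w∈
    ...           | U₂ , q₂ = loop fuel ((x , u) ∷ (y , w) ∷ Ms′) U₂
                    (trans (+-suc fuel _) (trans (cong (λ l → suc (fuel + l)) (sym lm)) len)) (xu ∷ yw ∷ es′)
                    (↭-trans (prep x (↭-trans (swap u y ↭-refl) (prep y insert)))
                      (↭-trans (++⁺ (↭-sym q) (↭-sym (↭-trans q₁ (prep u q₂)))) p))
      where
      insert : u ∷ w ∷ flat Ms′ ++ U₂ ↭ flat Ms′ ++ u ∷ w ∷ U₂
      insert = ↭-sym (↭-trans (shift u (flat Ms′) (w ∷ U₂)) (prep u (shift w (flat Ms′) U₂)))

-- Red neighbourhoods

AllPairs-resp-↭ : ∀ {R : A → A → Set} → Symmetric R → ∀ {xs ys} → xs ↭ ys → AllPairs R xs → AllPairs R ys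
AllPairs-resp-↭ s p = ↭ₛ.AllPairs-resp-↭ (setoid _) s ((λ { refl r → r }) , λ { refl r → r }) (↭⇒↭ₛ p)

partition-↭ : ∀ (p : A → Bool) xs → xs ↭ filterᵇ p xs ++ filterᵇ (not ∘ p) xs
partition-↭ p [] = ↭-refl
partition-↭ p (x ∷ xs) with p x
... | true  = prep x (partition-↭ p xs)
... | false = ↭-trans (prep x (partition-↭ p xs)) (↭-sym (shift x (filterᵇ p xs) _))

split-at : ∀ k (xs : List A) → k ≤ length xs → ∃₂ λ ys zs → xs ≡ ys ++ zs × length ys ≡ k
split-at k xs k≤ = take k xs , drop k xs , sym (List.take++drop≡id k xs) , trans (List.length-take k xs) (m≤n⇒m⊓n≡m k≤)

AllPairs-++⁻ˡ : ∀ {R : A → A → Set} xs {ys} → AllPairs R (xs ++ ys) → AllPairs R xs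
AllPairs-++⁻ˡ []       r        = []
AllPairs-++⁻ˡ (x ∷ xs) (r ∷ rs) = All.++⁻ˡ xs r ∷ AllPairs-++⁻ˡ xs rs

AllPairs-++⁻ʳ : ∀ {R : A → A → Set} xs {ys} → AllPairs R (xs ++ ys) → AllPairs R ys
AllPairs-++⁻ʳ []       r        = r
AllPairs-++⁻ʳ (x ∷ xs) (r ∷ rs) = AllPairs-++⁻ʳ xs rs

module _ {N : ℕ} (c : Colouring N) where

  packing-++ : ∀ {b k S T m n} → S # T → Packing c b k S m → Packing c b k T n → Packing c b k (S ++ T) (m + n)
  packing-++ {S = S} S#T (Ks , (refl , sK) , cK , dK) (Ls , (refl , sL) , cL , dL) =
    Ks ++ Ls ,
    (List.length-++ Ks , All.++⁺ (All.map (λ (l , K⊆) → l , All.map ∈-++⁺ˡ K⊆) sK)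
                                 (All.map (λ (l , L⊆) → l , All.map (∈-++⁺ʳ S) L⊆) sL)) ,
    All.++⁺ cK cL ,
    AllPairs.++⁺ dK dL (All.map (λ (_ , K⊆) → All.map (λ (_ , L⊆) →
      All.map (λ x∈S x∈L → All.lookup S#T x∈S (All.lookup L⊆ x∈L)) K⊆) sL) sK)

  packing-clique : ∀ {b K} → Clique c b K → Packing c b (length K) K 1
  packing-clique {K = K} cl = K ∷ [] , (refl , (refl , All.tabulate id) ∷ []) , cl ∷ [] , [] ∷ []

  chunks : ∀ {b} k n {P} → Clique c b P → n * k ≤ length P → Packing c b k P n
  chunks k zero cl _ = [] , (refl , []) , [] , []
  chunks {b} k (suc n) {P} cl le with split-at k P (≤-trans (m≤m+n k (n * k)) le)
  ... | Q , R , refl , refl =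
    packing-++ (proj₂ (proj₂ (unique-++ {xs = Q} (clique-unique c cl)))) (packing-clique (AllPairs-++⁻ˡ Q cl))
      (chunks (length Q) n (AllPairs-++⁻ʳ Q cl)
        (+-cancelˡ-≤ (length Q) _ _ (≤-trans le (≤-reflexive (List.length-++ Q)))))

  clique-take : ∀ {b} k {P} → Clique c b P → k ≤ length P → ∃ λ K → length K ≡ k × All (_∈ P) K × Clique c b K
  clique-take k {P} cl le with chunks k 1 cl (≤-trans (≤-reflexive (+-identityʳ k)) le)
  ... | K ∷ [] , (_ , (len , K⊆) ∷ []) , clK ∷ [] , _ = K , len , K⊆ , clK

  off-self : ∀ {b P x} → x ∉ P → cnt (adj c b x) P + cnt (adj c (not b) x) P ≡ length P
  off-self {b} {P} {x} x∉ = trans (cong (cnt (adj c b x) P +_) (≤-antisym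
      (cnt-mono P λ {y} y∈ e → cong not (bool-eq y∈ e))
      (cnt-mono P λ {y} y∈ e → adj-other c b (λ { refl → x∉ y∈ }) (not-true e))))
    (cnt-split (adj c b x) P)
    where
    bool-eq : ∀ {y} → y ∈ P → E c (not b) x y → adj c b x y ≡ false
    bool-eq {y} y∈ e with bool-cases (adj c b x y)
    ... | inj₂ f = f
    ... | inj₁ f = ⊥-elim (not-¬ (E⇒col c f) (E⇒col c e))

  take-neighbours : ∀ b g {x P} → x ∉ P → cnt (adj c (not b) x) P ≤ 1 → g + 1 ≤ length P →
                    ∃₂ λ G P′ → P ↭ G ++ P′ × length G ≡ g × All (E c b x) G
  take-neighbours b g {x} {P} x∉P x≤1 long with split-at g (filterᵇ (adj c b x) P) enough
    where
    enough : g ≤ length (filterᵇ (adj c b x) P)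
    enough = ≤-trans (linear g (cnt (adj c b x) P) 0 (+-mono-≤ (+-mono-≤ x≤1 long)
                (≤-reflexive (sym (off-self {b} {P} x∉P)))) (arith g (cnt (adj c b x) P) _ (length P)))
              (≤-reflexive (sym (length-filterᵇ (adj c b x) P)))
      where
      arith : ∀ g p q l → g + (1 + l + (p + q)) + 0 ≡ p + (q + (g + 1) + l)
      arith = solve-∀
  ... | G , G′ , eq , |G| = G , G′ ++ filterᵇ (not ∘ adj c b x) P ,
    subst (P ↭_) (trans (cong (_++ filterᵇ (not ∘ adj c b x) P) eq) (List.++-assoc G G′ _)) (partition-↭ (adj c b x) P) ,
    |G| , All.tabulate λ y∈ → proj₂ (∈-filterᵇ⁻ (adj c b x) P (subst (_ ∈_) (sym eq) (∈-++⁺ˡ y∈)))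

  -- Each vertex of `xs` is completed to a clique by `g` vertices of the clique `P`. The remainder
  -- `R` is recorded because further cliques may be cut from it.
  record Grouping (b : Bool) (g : ℕ) (xs P : List (Fin N)) : Set where
    constructor grouping
    field
      S R     : List (Fin N)
      S⊆      : All (_∈ xs ++ P) S
      R⊆      : All (_∈ P) R
      S#R     : S # R
      groups  : Packing c b (suc g) S (length xs)
      clique  : Clique c b R
      |R|     : length R + length xs * g ≡ length P

  -- Each x misses at most one vertex of the clique, so one spare vertex is enough for a greedy choice.
  group : ∀ b g xs {P} → Clique c b P → Unique xs → xs # P → All (λ x → cnt (adj c (not b) x) P ≤ 1) xs →
          length xs * g + 1 ≤ length P → Grouping b g xs P
  group b g [] {P} cl _ _ _ _ = grouping [] P [] (All.tabulate id) [] ([] , (refl , []) , [] , []) cl (+-identityʳ _)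
  group b g (x ∷ xs) {P} cl (x∉xs ∷ xs!) (x∉P ∷ xs#P) (x≤1 ∷ few) long
    with take-neighbours b g x∉P x≤1 (≤-trans (+-monoˡ-≤ 1 (m≤m+n g _)) long)
  ... | G , P′ , p , refl , xG
    with AllPairs-resp-↭ (E-sym c {b}) p cl | unique-++ {xs = G} (Unique-resp-↭ p (clique-unique c cl))
  ... | clGP′ | G! , P′! , G#P′
    with group b (length G) xs {P′} (AllPairs-++⁻ʳ G clGP′) xs! (All.map (λ x∉ → x∉ ∘ P′⊆) xs#P) (All.map few′ few) long′
    where
    P′⊆ : ∀ {y} → y ∈ P′ → y ∈ P
    P′⊆ = ∈-resp-↭ (↭-sym p) ∘ ∈-++⁺ʳ G
    few′ : ∀ {x} → cnt (adj c (not b) x) P ≤ 1 → cnt (adj c (not b) x) P′ ≤ 1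
    few′ {x} = ≤-trans (≤-trans (m≤n+m _ _) (≤-reflexive (trans (sym (cnt-++ (adj c (not b) x) G P′))
                 (sym (cnt-↭ (adj c (not b) x) p)))))
    long′ : length xs * length G + 1 ≤ length P′
    long′ = +-cancelˡ-≤ (length G) _ _ (≤-trans (≤-reflexive (sym (+-assoc (length G) _ 1)))
              (≤-trans long (≤-reflexive (trans (↭-length p) (List.length-++ G)))))
  ... | grouping S R S⊆ R⊆ S#R groups clR |R| = grouping ((x ∷ G) ++ S) R
    (here refl ∷ All.++⁺ (All.tabulate (λ y∈ → there (∈-++⁺ʳ xs (G⊆ y∈)))) (All.map S⊆xsP S⊆))
    (All.map P′⊆ R⊆)
    (All.++⁺ ((λ x∈R → x∉P (P′⊆ (All.lookup R⊆ x∈R))) ∷ All.map (λ y∉ → y∉ ∘ All.lookup R⊆) G#P′) S#R)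
    (packing-++ ((λ x∈S → [ (λ x∈xs → All.lookup x∉xs x∈xs refl) , x∉P ∘ P′⊆ ]′ (∈-++⁻ xs (All.lookup S⊆ x∈S))) ∷
                 All.tabulate (λ y∈G y∈S → [ (λ y∈xs → All.lookup xs#P y∈xs (G⊆ y∈G)) , All.lookup G#P′ y∈G ]′
                                             (∈-++⁻ xs (All.lookup S⊆ y∈S))))
                (packing-clique (xG ∷ AllPairs-++⁻ˡ G clGP′)) groups)
    clR
    (trans (x∙yz≈y∙xz (length R) (length G) _) (trans (cong (length G +_) |R|) (sym (trans (↭-length p) (List.length-++ G)))))
    where
    P′⊆ : ∀ {y} → y ∈ P′ → y ∈ P
    P′⊆ = ∈-resp-↭ (↭-sym p) ∘ ∈-++⁺ʳ G
    G⊆ : ∀ {y} → y ∈ G → y ∈ P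
    G⊆ = ∈-resp-↭ (↭-sym p) ∘ ∈-++⁺ˡ
    S⊆xsP : ∀ {y} → y ∈ xs ++ P′ → y ∈ x ∷ xs ++ P
    S⊆xsP y∈ = there ([ ∈-++⁺ˡ , ∈-++⁺ʳ xs ∘ P′⊆ ]′ (∈-++⁻ xs y∈))

  -- Each `x` excludes at most one vertex of `U`, so some vertex of `U` survives.
  centre : ∀ b {xs U} → All (λ x → cnt (adj c b x) U ≤ 1) xs → length xs < length U →
           ∃ λ u → u ∈ U × All (λ x → adj c b x u ≡ false) xs
  centre b {xs} {U} few lt with Any.any? (λ u → cnt (λ x → adj c b x u) xs Nat.≟ 0) U
  ... | yes a = case find a of λ (u , u∈ , none) → u , u∈ , All.tabulate (cnt-none xs none)
  ... | no ¬a = ⊥-elim (<⇒≱ lt (≤-trans (≤-reflexive (sym (+-identityʳ _)))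
      (≤-trans (double-count (λ u x → adj c b x u) U xs 1 1 (λ {u} u∈ → n≢0⇒n>0 (λ none → ¬a (lose u∈ none))) (All.lookup few))
        (≤-reflexive (*-identityʳ _)))))

  module _ {m : ℕ} (no-fan : ¬ FanIn c true 2 m) where

    -- An independent set of red edges in the neighbourhood has fewer than m edges, and the rest is blue.
    blue-clique-in-red-nbhd : ∀ {v L s} → Unique L → (∀ {w} → w ∈ L → E c true v w) → 2 * m + s ≤ length L + 2 →
      ∃ λ K → length K ≡ s × All (_∈ L) K × Clique c false K
    blue-clique-in-red-nbhd {v} {L} {s} L! red long with matching-or-stuck c true L! m
    ... | inj₁ p = ⊥-elim (no-fan (fan-at c red p))
    ... | inj₂ (xs , U , k<m , |U| , cl , _ , _ , ⊆L) with clique-take s cl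
          (linear s (length U) 0 (+-mono-≤ (+-mono-≤ (*-monoʳ-≤ 2 k<m) long) (≤-reflexive (sym |U|))) (arith (length U) (length xs) m s (length L)))
      where
      arith : ∀ u k m s l → s + (2 * m + (l + 2) + (u + 2 * k)) + 0 ≡ u + (2 * (1 + k) + (2 * m + s) + l)
      arith = solve-∀
    ...   | K , len , K⊆ , clK = K , len , All.map (All.lookup ⊆L ∘ ∈-++⁺ʳ xs) K⊆ , clK

    -- If augmentation stops at `k < e` edges, then `U` is a red clique with at least `2m + e - 2k`
    -- vertices, and some `z` in it is red to all of `xs`. So `z` is red to `k + (length U - 1)`
    -- vertices, at least `2m` of them. Pairing each `x` with a vertex of `U` and splitting the
    -- remaining clique into pairs produces a red `F_m`.
    blue-matching : ∀ {L e} → Unique L → e ≤ m → 2 * m + e ≤ length L → Packing c false 2 L e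
    blue-matching {L} {e} L! e≤m long with matching-or-stuck c false L! e
    ... | inj₁ p = p
    ... | inj₂ (xs , U , k<e , |U| , cl , few , xsU! , ⊆L) with centre false few k<|U|
      where
      k<|U| : length xs < length U
      k<|U| = linear (suc (length xs)) (length U) 2 (+-mono-≤ (+-mono-≤ (+-mono-≤ (*-monoʳ-≤ 3 k<e) (*-monoʳ-≤ 2 e≤m)) long) (≤-reflexive (sym |U|)))
                (arith (length xs) (length U) e m (length L))
        where
        arith : ∀ k u e m l → suc k + (3 * e + 2 * m + l + (u + 2 * k)) + 2 ≡ u + (3 * suc k + 2 * e + (2 * m + e) + l)
        arith = solve-∀
    ...   | z , z∈ , xz with pick z∈
    ...     | P , p with AllPairs-resp-↭ (E-sym c {true}) p cl | unique-++ {xs = xs} xsU!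
    ...       | zP ∷ clP | xs! , _ , xs#U with group true 1 xs clP xs! (All.map (λ x∉ → x∉ ∘ P⊆) xs#U) (All.map few′ few) enough
      where
      P⊆ : ∀ {y} → y ∈ P → y ∈ U
      P⊆ = ∈-resp-↭ (↭-sym p) ∘ there
      few′ : ∀ {x} → cnt (adj c false x) U ≤ 1 → cnt (adj c false x) P ≤ 1
      few′ {x} = ≤-trans (≤-trans (m≤n+m _ _) (≤-reflexive (sym (cnt-↭ (adj c false x) p))))
      enough : length xs * 1 + 1 ≤ length P
      enough = linear (length xs * 1 + 1) (length P) 1
        (+-mono-≤ (+-mono-≤ (+-mono-≤ (*-monoʳ-≤ 3 k<e) (*-monoʳ-≤ 2 e≤m)) long)
          (≤-reflexive (trans (sym |U|) (cong (_+ 2 * length xs) (↭-length p)))))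
        (arith (length xs) (length P) e m (length L))
        where
        arith : ∀ k u e m l → (k * 1 + 1) + (3 * e + 2 * m + l + ((1 + u) + 2 * k)) + 1 ≡ u + (3 * suc k + 2 * e + (2 * m + e) + l)
        arith = solve-∀
    ...         | grouping S R S⊆ R⊆ S#R groups clR |R| = ⊥-elim (no-fan (fan-at c red
                  (subst (Packing c true 2 (S ++ R)) (m+[n∸m]≡n k≤m) (packing-++ S#R groups (chunks 2 (m ∸ length xs) clR rest)))))
      where
      k≤m : length xs ≤ m
      k≤m = ≤-trans (<⇒≤ k<e) e≤m
      rest : (m ∸ length xs) * 2 ≤ length R
      rest = linear ((m ∸ length xs) * 2) (length R) 0
        (+-mono-≤ (+-mono-≤ (+-mono-≤ (+-mono-≤ k<e long) (≤-reflexive (sym |R|)))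
          (≤-reflexive (trans (sym |U|) (cong (_+ 2 * length xs) (↭-length p)))))
          (≤-reflexive (cong (2 *_) (m+[n∸m]≡n k≤m))))
        (arith (length xs) (m ∸ length xs) (length R) e m (length L) (length P))
        where
        arith : ∀ k d r e m l p → d * 2 + (e + l + (r + k * 1) + (1 + p + 2 * k) + 2 * m) + 0 ≡
                                  r + (suc k + (2 * m + e) + p + l + 2 * (k + d))
        arith = solve-∀
      redP : ∀ {w} → w ∈ P → E c true z w
      redP = All.lookup zP
      red : ∀ {w} → w ∈ S ++ R → E c true z w
      red w∈ with ∈-++⁻ S w∈
      ... | inj₂ w∈R = redP (All.lookup R⊆ w∈R)
      ... | inj₁ w∈S with ∈-++⁻ xs (All.lookup S⊆ w∈S)
      ...   | inj₂ w∈P  = redP w∈P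
      ...   | inj₁ w∈xs = E-sym c (adj-other c false (λ { refl → All.lookup xs#U w∈xs z∈ }) (All.lookup xz w∈xs))

  -- With at least `n` ends, the `n r + 2` vertices of `U` supply the centre, `r` partners for each
  -- of `n` ends, and the spare vertex needed by `group`. With fewer ends, `3 * n ≤ 2 * m` makes `U`
  -- so large that it contains the fan alone.
  blue-fan-in-red-nbhd : ∀ {m n r L} → 1 ≤ r → 3 * n ≤ 2 * m → Unique L → 2 * m + n * r ≤ length L →
    Packing c true 2 L m ⊎ FanIn c false (suc r) n
  blue-fan-in-red-nbhd {m} {n} {r} {L} 1≤r 3n≤2m L! long with matching-or-stuck c true L! m
  ... | inj₁ p = inj₁ p
  ... | inj₂ (xs , U , k<m , |U| , cl , few , xsU! , ⊆L) with n ≤? length xs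
  ...   | no n≰k = inj₂ (clique-fan cl
            (linear (n * suc r + 1) (length U) 1 (+-mono-≤ (+-mono-≤ (+-mono-≤ (*-monoʳ-≤ 2 (≰⇒> n≰k)) 3n≤2m) long) (≤-reflexive (sym |U|)))
              (arith (length U) (length xs) n r m (length L))))
    where
    arith : ∀ u k n r m l → n * suc r + 1 + (2 * n + 2 * m + l + (u + 2 * k)) + 1 ≡ u + (2 * suc k + 3 * n + (2 * m + n * r) + l)
    arith = solve-∀
    clique-fan : ∀ {U} → Clique c false U → n * suc r + 1 ≤ length U → FanIn c false (suc r) n
    clique-fan {[]} _ le = case ≤-trans (≤-reflexive (+-comm 1 (n * suc r))) le of λ ()
    clique-fan {u ∷ U} (uU ∷ cl) le = fan-at c (All.lookup uU) (chunks (suc r) n cl (≤-pred (≤-trans (≤-reflexive (+-comm 1 _)) le)))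
  ...   | yes n≤k with split-at n xs n≤k
  ...     | xs₁ , ys , refl , refl with centre true (All.++⁻ˡ xs₁ few) (≤-trans (s≤s (≤-trans (≤-reflexive (sym (*-identityʳ _))) (*-monoʳ-≤ (length xs₁) 1≤r))) (<⇒≤ |U|-large))
    where
    |U|-large : suc (suc (length xs₁ * r)) ≤ length U
    |U|-large = linear (2 + length xs₁ * r) (length U) 0 (+-mono-≤ (+-mono-≤ (*-monoʳ-≤ 2 k<m) long) (≤-reflexive (sym |U|)))
      (arith (length U) (length (xs₁ ++ ys)) (length xs₁ * r) m (length L))
      where
      arith : ∀ u k w m l → 2 + w + (2 * m + l + (u + 2 * k)) + 0 ≡ u + (2 * suc k + (2 * m + w) + l)
      arith = solve-∀
  ...       | u , u∈ , ux with pick u∈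
  ...         | P , p with AllPairs-resp-↭ (E-sym c {false}) p cl | unique-++ {xs = xs₁ ++ ys} xsU!
  ...           | uP ∷ clP | xs! , _ , xs#U with group false r xs₁ clP (proj₁ (unique-++ xs!))
                    (All.map (λ x∉ → x∉ ∘ ∈-resp-↭ (↭-sym p) ∘ there) (All.++⁻ˡ xs₁ xs#U))
                    (All.map few′ (All.++⁻ˡ xs₁ few)) enough
    where
    few′ : ∀ {x} → cnt (adj c true x) U ≤ 1 → cnt (adj c true x) P ≤ 1
    few′ {x} = ≤-trans (≤-trans (m≤n+m _ _) (≤-reflexive (sym (cnt-↭ (adj c true x) p))))
    enough : length xs₁ * r + 1 ≤ length P
    enough = linear (length xs₁ * r + 1) (length P) 0
      (+-mono-≤ (+-mono-≤ (*-monoʳ-≤ 2 k<m) long) (≤-reflexive (trans (sym |U|) (cong (_+ 2 * length (xs₁ ++ ys)) (↭-length p)))))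
      (arith (length P) (length (xs₁ ++ ys)) (length xs₁ * r) m (length L))
      where
      arith : ∀ u k w m l → w + 1 + (2 * m + l + (1 + u + 2 * k)) + 0 ≡ u + (2 * suc k + (2 * m + w) + l)
      arith = solve-∀
  ...             | grouping S R S⊆ _ _ groups _ _ = inj₂ (fan-at c blue groups)
    where
    blue : ∀ {w} → w ∈ S → E c false u w
    blue w∈ with ∈-++⁻ xs₁ (All.lookup S⊆ w∈)
    ... | inj₂ w∈P = All.lookup uP w∈P
    ... | inj₁ w∈xs = E-sym c (adj-other c true (λ { refl → All.lookup xs#U (∈-++⁺ˡ w∈xs) u∈ }) (All.lookup ux w∈xs))

-- Blue neighbourhoods

∧-true : ∀ {a b} → a ∧ b ≡ true → a ≡ true × b ≡ true
∧-true {true} {true} _ = refl , refl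

∨-true : ∀ {a b} → a ∨ b ≡ true → a ≡ true ⊎ b ≡ true
∨-true {true}  e = inj₁ refl
∨-true {false} e = inj₂ e

true-∧ : ∀ {a b} → a ≡ true → b ≡ true → a ∧ b ≡ true
true-∧ refl refl = refl

does-true : ∀ {P : Set} (P? : Dec P) → does P? ≡ true → P
does-true (yes p) _ = p

Σ[_] : List ℕ → (ℕ → ℕ) → ℕ
Σ[ js ] g = sum (map g js)

Σ-↭ : ∀ g {js ks} → js ↭ ks → Σ[ js ] g ≡ Σ[ ks ] g
Σ-↭ g p = sum-↭ (map⁺ g p)

Σ-const : ∀ js (g h : ℕ → ℕ) k → (∀ {j} → j ∈ js → g j + h j ≡ k) → Σ[ js ] g + Σ[ js ] h ≡ length js * k
Σ-const []       g h k e = refl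
Σ-const (j ∷ js) g h k e = trans (interchange (g j) _ (h j) _) (cong₂ _+_ (e (here refl)) (Σ-const js g h k (e ∘ there)))

Σ-suc : ∀ g js → Σ[ js ] (λ j → suc (g j)) ≡ Σ[ js ] g + length js
Σ-suc g []       = refl
Σ-suc g (j ∷ js) = trans (cong suc (trans (cong (g j +_) (Σ-suc g js)) (sym (+-assoc (g j) _ _)))) (sym (+-suc _ _))

term≤Σ : ∀ g {j js} → j ∈ js → g j ≤ Σ[ js ] g
term≤Σ g (here refl)          = m≤m+n _ _
term≤Σ g {js = k ∷ _} (there i) = ≤-trans (term≤Σ g i) (m≤n+m _ (g k))

cnt-cover : ∀ (f : A → ℕ) (p : A → Bool) W r → (∀ {x} → x ∈ W → p x ≡ true → f x < r) →
            cnt p W ≤ Σ[ downFrom r ] (λ j → cnt (λ x → does (f x Nat.≟ j)) W)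
cnt-cover f p W zero f< with cnt p W in eq
... | zero  = z≤n
... | suc _ = case cnt-pos W (≤-trans (s≤s z≤n) (≤-reflexive (sym eq))) of λ (x , x∈ , px) → case f< x∈ px of λ ()
cnt-cover f p W (suc r) f< = ≤-trans (cnt-∪ W split) (+-monoʳ-≤ _ (cnt-cover f p′ W r f<′))
  where
  p′ : _ → Bool
  p′ x = p x ∧ not (does (f x Nat.≟ r))
  split : ∀ {x} → x ∈ W → p x ≡ true → does (f x Nat.≟ r) ≡ true ⊎ p′ x ≡ true
  split {x} _ px with does (f x Nat.≟ r)
  ... | true  = inj₁ refl
  ... | false = inj₂ (true-∧ px refl)
  f<′ : ∀ {x} → x ∈ W → p′ x ≡ true → f x < r
  f<′ {x} x∈ px = ≤∧≢⇒< (≤-pred (f< x∈ (proj₁ (∧-true {p x} px))))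
    λ eq → false≢true (cong not (dec-true (f x Nat.≟ r) eq)) (proj₂ (∧-true {p x} px))

module _ {N : ℕ} (c : Colouring N) where

  -- Red or equal: independent sets are blue cliques, and vertices of one colour class form a red
  -- clique.
  ρ : Rel (Fin N)
  ρ u v = not (adj c false u v)

  ρ-refl : ∀ u → ρ u u ≡ true
  ρ-refl u = cong not (adj-irrefl c false u)

  ρ-sym : ∀ u v → ρ u v ≡ ρ v u
  ρ-sym u v = cong not (adj-sym c false u v)

  blue⇒ρ : ∀ {u v} → E c false u v → ρ u v ≡ false
  blue⇒ρ = cong not

  ρ⇒blue : ∀ {u v} → ρ u v ≡ false → E c false u v
  ρ⇒blue {u} {v} e with adj c false u v
  ... | true = refl

  ρ⇒red : ∀ {u v} → u ≢ v → ρ u v ≡ true → E c true u v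
  ρ⇒red {u} {v} u≢v e = adj-other c false u≢v (not-true e)

  mem : List (Fin N) → Fin N → Bool
  mem K v = does (Any.any? (v ≟ᶠ_) K)

  mem⁻ : ∀ {K v} → mem K v ≡ true → v ∈ K
  mem⁻ {K} {v} = does-true (Any.any? (v ≟ᶠ_) K)

  not-mem : ∀ {K v} → not (mem K v) ≡ true → v ∉ K
  not-mem {K} {v} e v∈ rewrite dec-true (Any.any? (v ≟ᶠ_) K) v∈ = false≢true refl e

  cnt-eq≤1 : ∀ (u : Fin N) {W} → Unique W → cnt (λ v → does (u ≟ᶠ v)) W ≤ 1
  cnt-eq≤1 u W! = cnt-≤1 W! λ {v} {w} _ _ p q → trans (sym (does-true (u ≟ᶠ v) p)) (does-true (u ≟ᶠ w) q)

  cnt-mem : ∀ K {W} → Unique W → cnt (mem K) W ≤ length K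
  cnt-mem []      {W} W! = ≤-trans (cnt-mono {q = λ _ → false} W (λ _ e → e)) (≤-reflexive (none W))
    where
    none : ∀ W → cnt (λ _ → false) W ≡ 0
    none []      = refl
    none (_ ∷ W) = none W
  cnt-mem (k ∷ K) {W} W! = ≤-trans (cnt-∪ {q = λ v → does (k ≟ᶠ v)} {mem K} W split) (+-mono-≤ (cnt-eq≤1 k W!) (cnt-mem K W!))
    where
    split : ∀ {v} → v ∈ W → mem (k ∷ K) v ≡ true → does (k ≟ᶠ v) ≡ true ⊎ mem K v ≡ true
    split {v} _ e with mem⁻ {k ∷ K} e
    ... | here refl = inj₁ (dec-true (k ≟ᶠ k) refl)
    ... | there i   = inj₂ (dec-true (Any.any? (v ≟ᶠ_) K) i)

  closed-count : ∀ (p : Fin N → Bool) x {W} → Unique W →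
                 cnt (λ z → p z ∧ ρ x z) W ≤ 1 + cnt (λ z → p z ∧ adj c true x z) W
  closed-count p x {W} W! = ≤-trans (cnt-∪ {q = λ z → does (x ≟ᶠ z)} {λ z → p z ∧ adj c true x z} W split) (+-monoˡ-≤ _ (cnt-eq≤1 x W!))
    where
    split : ∀ {z} → z ∈ W → p z ∧ ρ x z ≡ true → does (x ≟ᶠ z) ≡ true ⊎ p z ∧ adj c true x z ≡ true
    split {z} _ e = case x ≟ᶠ z of λ where
      (yes x≡z) → inj₁ (dec-true (x ≟ᶠ z) x≡z)
      (no x≢z)  → inj₂ (true-∧ (proj₁ (∧-true {p z} e)) (ρ⇒red x≢z (proj₂ (∧-true {p z} e))))

  pack-or-none : ∀ t n {L} → Unique L → Packing c false t L (suc n) ⊎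
                 (∃ λ W → Unique W × (∀ {v} → v ∈ W → v ∈ L) × NoIndep ρ W t × length L ≤ length W + n * t)
  pack-or-none t n {L} L! = loop (suc n) 0 [] L (+-identityʳ _) ([] , (refl , []) , [] , []) [] (λ ()) id L! (≤-reflexive (sym (+-identityʳ _)))
    where
    loop : ∀ fuel k S W → fuel + k ≡ suc n → Packing c false t S k → S # W → (∀ {v} → v ∈ S → v ∈ L) →
           (∀ {v} → v ∈ W → v ∈ L) → Unique W → length L ≤ length W + k * t →
           Packing c false t L (suc n) ⊎
           (∃ λ W → Unique W × (∀ {v} → v ∈ W → v ∈ L) × NoIndep ρ W t × length L ≤ length W + n * t)
    loop zero k S W refl p _ S⊆ _ _ _ = inj₁ (packing-⊆ c S⊆ p)
    loop (suc fuel) k S W len p S#W S⊆ W⊆ W! size with indepSet? _≟ᶠ_ ρ W t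
    ... | no ¬K = inj₂ (W , W! , W⊆ , (λ K⊆ ind l → ¬K (_ , (l , K⊆) , ind)) ,
        ≤-trans size (+-monoʳ-≤ _ (*-monoˡ-≤ t (≤-trans (m≤n+m k fuel) (≤-reflexive (suc-injective len))))))
    ... | yes (K , (refl , K⊆W) , ind) = loop fuel (suc k) (K ++ S) (filterᵇ (not ∘ mem K) W) (trans (+-suc _ _) len)
        (packing-++ c (All.map (λ x∈W x∈S → All.lookup S#W x∈S x∈W) K⊆W) (packing-clique c (AllPairs.map ρ⇒blue ind)) p)
        (All.++⁺ (All.tabulate λ x∈K x∈ → not-mem (proj₂ (∈-filterᵇ⁻ (not ∘ mem K) W x∈)) x∈K)
                 (All.map (λ x∉ → x∉ ∘ proj₁ ∘ ∈-filterᵇ⁻ (not ∘ mem K) W) S#W))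
        (λ v∈ → [ W⊆ ∘ All.lookup K⊆W , S⊆ ]′ (∈-++⁻ K v∈))
        (W⊆ ∘ proj₁ ∘ ∈-filterᵇ⁻ (not ∘ mem K) W)
        (AllPairs-filterᵇ (not ∘ mem K) W!)
        (≤-trans size (linear (length W + k * length K) (length (filterᵇ (not ∘ mem K) W) + suc k * length K) 0
          (+-mono-≤ (cnt-mem K W!) (≤-reflexive (sym (cnt-split (mem K) W))))
          (trans (arith (length W) (cnt (mem K) W) (cnt (not ∘ mem K) W) (length K) k)
            (cong (λ l → l + suc k * length K + (cnt (mem K) W + length W)) (sym (length-filterᵇ (not ∘ mem K) W))))))
      where
      arith : ∀ w p q l k → w + k * l + (l + (p + q)) + 0 ≡ q + suc k * l + (p + w)
      arith = solve-∀

  -- With `2m + q` red neighbours in `W`, the part of them left over by a maximal red matching would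
  -- contain a blue clique on `q + 2` vertices. The count `cnt (ρ u) W` exceeds the red degree by at
  -- most one, for `u` itself.
  degree-bound : ∀ {m} → ¬ FanIn c true 2 m → ∀ {W q u} → Unique W → NoIndep ρ W (suc (suc q)) → cnt (ρ u) W ≤ 2 * m + q
  degree-bound {m} no-fan {W} {q} {u} W! none with cnt (ρ u) W ≤? 2 * m + q
  ... | yes le = le
  ... | no ≰   = case blue-clique-in-red-nbhd c no-fan {L = filterᵇ (adj c true u) W} {suc (suc q)} (AllPairs-filterᵇ (adj c true u) W!)
      (proj₂ ∘ ∈-filterᵇ⁻ (adj c true u) W) long of
      λ (K , len , K⊆ , cl) → ⊥-elim (none (All.map (proj₁ ∘ ∈-filterᵇ⁻ (adj c true u) W) K⊆) (AllPairs.map blue⇒ρ cl) len)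
    where
    long : 2 * m + suc (suc q) ≤ length (filterᵇ (adj c true u) W) + 2
    long = ≤-trans (linear (2 * m + suc (suc q)) (cnt (adj c true u) W + 2) 0 (+-mono-≤ (≰⇒> ≰) (closed-count (λ _ → true) u W!))
             (arith (2 * m) q (cnt (ρ u) W) (cnt (adj c true u) W)))
             (≤-reflexive (cong (_+ 2) (sym (length-filterᵇ (adj c true u) W))))
      where
      arith : ∀ m q r a → m + suc (suc q) + (r + (1 + a)) + 0 ≡ a + 2 + (suc (m + q) + r)
      arith = solve-∀

  -- Red degrees into the colour classes

  module Classes {m : ℕ} (no-fan : ¬ FanIn c true 2 m) {W : List (Fin N)} (W! : Unique W)
    (f : Fin N → ℕ) (same : ∀ {u v} → u ∈ W → v ∈ W → f u ≡ f v → ρ u v ≡ true) where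

    class : ℕ → Fin N → Bool
    class j z = does (f z Nat.≟ j)

    class⁻ : ∀ {j z} → class j z ≡ true → f z ≡ j
    class⁻ {j} {z} = does-true (f z Nat.≟ j)

    size : ℕ → ℕ
    size j = cnt (class j) W

    reds : ℕ → Fin N → ℕ
    reds j x = cnt (λ z → class j z ∧ ρ x z) W

    not-blue : ∀ {u v} → u ∈ W → v ∈ W → f u ≡ f v → E c false u v → ⊥
    not-blue u∈ v∈ eq e = false≢true (blue⇒ρ e) (same u∈ v∈ eq)

    -- More would give `x` at least `2m + 1` red neighbours in the two classes and hence a blue
    -- triangle there, two of whose corners share a red clique. The summand 1 allows for `x` itself.
    reds-two : ∀ x {i j} → i ≢ j → reds i x + reds j x ≤ 2 * m + 1
    reds-two x {i} {j} i≢j with reds i x + reds j x ≤? 2 * m + 1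
    ... | yes le = le
    ... | no ≰ = case blue-clique-in-red-nbhd c no-fan {L = filterᵇ s W} {3} (AllPairs-filterᵇ s W!)
        (λ {w} w∈ → proj₂ (∧-true {either w} (proj₂ (∈-filterᵇ⁻ s W w∈)))) long of no-triangle
      where
      either : Fin N → Bool
      either z = class i z ∨ class j z
      s : Fin N → Bool
      s z = either z ∧ adj c true x z
      long : 2 * m + 3 ≤ length (filterᵇ s W) + 2
      long = ≤-trans (linear (2 * m + 3) (cnt s W + 2) 0 (+-mono-≤ (+-mono-≤ (≰⇒> ≰)
               (cnt-⊎ {r = λ z → either z ∧ ρ x z} W left right apart)) (closed-count either x W!))
               (arith (2 * m) (reds i x) (reds j x) (cnt (λ z → either z ∧ ρ x z) W) (cnt s W)))
               (≤-reflexive (cong (_+ 2) (sym (length-filterᵇ s W))))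
        where
        arith : ∀ m a b r s → m + 3 + ((a + b) + r + (1 + s)) + 0 ≡ s + 2 + (suc (m + 1) + (a + b) + r)
        arith = solve-∀
        left : ∀ {z} → z ∈ W → class i z ∧ ρ x z ≡ true → either z ∧ ρ x z ≡ true
        left {z} _ e with class i z
        ... | true = e
        right : ∀ {z} → z ∈ W → class j z ∧ ρ x z ≡ true → either z ∧ ρ x z ≡ true
        right {z} _ e with class i z | class j z
        ... | true  | true = e
        ... | false | true = e
        apart : ∀ {z} → z ∈ W → class i z ∧ ρ x z ≡ true → class j z ∧ ρ x z ≡ true → ⊥
        apart {z} _ e e′ = i≢j (trans (sym (class⁻ (proj₁ (∧-true {class i z} e)))) (class⁻ (proj₁ (∧-true {class j z} e′))))
      in-two : ∀ {z} → z ∈ filterᵇ s W → z ∈ W × (f z ≡ i ⊎ f z ≡ j)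
      in-two {z} z∈ with ∈-filterᵇ⁻ s W z∈
      ... | z∈W , e = z∈W , [ inj₁ ∘ class⁻ , inj₂ ∘ class⁻ ]′ (∨-true {class i z} (proj₁ (∧-true {either z} e)))
      no-triangle : (∃ λ K → length K ≡ 3 × All (_∈ filterᵇ s W) K × Clique c false K) → reds i x + reds j x ≤ 2 * m + 1
      no-triangle (u ∷ v ∷ w ∷ [] , refl , (u∈ ∷ v∈ ∷ w∈ ∷ []) , ((uv ∷ uw ∷ []) ∷ (vw ∷ []) ∷ [] ∷ []))
        with in-two u∈ | in-two v∈ | in-two w∈
      ... | u∈ , inj₁ p | v∈ , inj₁ q | _           = ⊥-elim (not-blue u∈ v∈ (trans p (sym q)) uv)
      ... | u∈ , inj₂ p | v∈ , inj₂ q | _           = ⊥-elim (not-blue u∈ v∈ (trans p (sym q)) uv)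
      ... | u∈ , inj₁ p | _           | w∈ , inj₁ q = ⊥-elim (not-blue u∈ w∈ (trans p (sym q)) uw)
      ... | u∈ , inj₂ p | _           | w∈ , inj₂ q = ⊥-elim (not-blue u∈ w∈ (trans p (sym q)) uw)
      ... | _           | v∈ , inj₁ p | w∈ , inj₁ q = ⊥-elim (not-blue v∈ w∈ (trans p (sym q)) vw)
      ... | _           | v∈ , inj₂ p | w∈ , inj₂ q = ⊥-elim (not-blue v∈ w∈ (trans p (sym q)) vw)

    reds-own : ∀ {x} → x ∈ W → size (f x) ≤ reds (f x) x
    reds-own {x} x∈ = cnt-mono W λ {z} z∈ e → true-∧ e (same x∈ z∈ (sym (class⁻ e)))

    -- A vertex of a larger class would have `2m` red neighbours within it, hence a blue edge inside
    -- a red clique.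
    size≤ : ∀ j → size j ≤ 2 * m
    size≤ j with size j ≤? 2 * m
    ... | yes le = le
    ... | no ≰ with cnt-pos W (≤-trans (s≤s z≤n) (≰⇒> ≰))
    ...   | x , x∈ , xj with class⁻ xj
    ...     | refl = case blue-clique-in-red-nbhd c no-fan {L = filterᵇ s W} {2} (AllPairs-filterᵇ s W!)
        (λ {w} w∈ → proj₂ (∧-true {class (f x) w} (proj₂ (∈-filterᵇ⁻ s W w∈)))) long of no-edge
      where
      s : Fin N → Bool
      s z = class (f x) z ∧ adj c true x z
      long : 2 * m + 2 ≤ length (filterᵇ s W) + 2
      long = ≤-trans (linear (2 * m + 2) (cnt s W + 2) 0 (+-mono-≤ (+-mono-≤ (≰⇒> ≰) (reds-own x∈)) (closed-count (class (f x)) x W!))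
               (arith (2 * m) (size (f x)) (reds (f x) x) (cnt s W)))
               (≤-reflexive (cong (_+ 2) (sym (length-filterᵇ s W))))
        where
        arith : ∀ m a r s → m + 2 + (a + r + (1 + s)) + 0 ≡ s + 2 + (suc m + a + r)
        arith = solve-∀
      in-class : ∀ {z} → z ∈ filterᵇ s W → z ∈ W × f z ≡ f x
      in-class {z} z∈ with ∈-filterᵇ⁻ s W z∈
      ... | z∈W , e = z∈W , class⁻ (proj₁ (∧-true {class (f x) z} e))
      no-edge : (∃ λ K → length K ≡ 2 × All (_∈ filterᵇ s W) K × Clique c false K) → size (f x) ≤ 2 * m
      no-edge (u ∷ v ∷ [] , refl , (u∈ ∷ v∈ ∷ []) , ((uv ∷ []) ∷ [] ∷ [])) with in-class u∈ | in-class v∈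
      ... | u∈ , p | v∈ , q = ⊥-elim (not-blue u∈ v∈ (trans p (sym q)) uv)

    deficit : ℕ → ℕ
    deficit j = 2 * m ∸ size j

    deficit+size : ∀ j → deficit j + size j ≡ 2 * m
    deficit+size j = m∸n+n≡m (size≤ j)

    -- All of the own class counts towards the bound `2m + 1` of `reds-two`; only this much is left
    -- for another class.
    reds-other : ∀ {x l} → x ∈ W → f x ≢ l → reds l x ≤ suc (deficit (f x))
    reds-other {x} {l} x∈ ≢l = linear (reds l x) (suc (deficit (f x))) 0
      (+-mono-≤ (+-mono-≤ (reds-two x ≢l) (reds-own x∈)) (≤-reflexive (sym (deficit+size (f x)))))
      (arith (reds l x) (reds (f x) x) (size (f x)) (deficit (f x)) (2 * m))
      where
      arith : ∀ a b s d m → a + (m + 1 + b + (d + s)) + 0 ≡ suc d + (b + a + s + m)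
      arith = solve-∀

-- Extending seeds to blue cliques

module Extension {N : ℕ} (c : Colouring N) {m : ℕ} (no-fan : ¬ FanIn c true 2 m)
  {W : List (Fin N)} (W! : Unique W)
  (f : Fin N → ℕ) (same : ∀ {u v} → u ∈ W → v ∈ W → f u ≡ f v → ρ c u v ≡ true) (r p : ℕ) where

  open Classes c no-fan W! f same

  Δ : ℕ
  Δ = Σ[ downFrom r ] deficit

  -- By `reds-other`, choosing a vertex in class `j` makes at most `suc (deficit j)` vertices of any
  -- other class unusable.
  cost : List ℕ → ℕ
  cost js = Σ[ js ] (suc ∘ deficit)

  available : (Fin N → Bool) → ℕ → ℕ
  available p l = cnt (λ z → class l z ∧ p z) W

  blue-to : Fin N → (Fin N → Bool) → Fin N → Bool
  blue-to x p z = adj c false x z ∧ p z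

  available-blue : ∀ p l x → available p l ≤ available (blue-to x p) l + reds l x
  available-blue p l x = cnt-∪ W split
    where
    split : ∀ {z} → z ∈ W → class l z ∧ p z ≡ true → class l z ∧ blue-to x p z ≡ true ⊎ class l z ∧ ρ c x z ≡ true
    split {z} _ e with adj c false x z
    ... | true  = inj₁ e
    ... | false = inj₂ (true-∧ (proj₁ (∧-true {class l z} e)) refl)

  fresh : List (List (Fin N)) → Fin N → Bool
  fresh []       z = true
  fresh (O ∷ Os) z = not (mem c O z) ∧ fresh Os z

  fresh⁻ : ∀ Os {z} → fresh Os z ≡ true → All (z ∉_) Os
  fresh⁻ []       _ = []
  fresh⁻ (O ∷ Os) {z} e with ∧-true {not (mem c O z)} e
  ... | z∉O , e′ = not-mem c z∉O ∷ fresh⁻ Os e′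

  -- A blue clique meets a red class in at most one vertex.
  available-fresh : ∀ Os l → All (Clique c false) Os → size l ≤ available (fresh Os) l + length Os
  available-fresh [] l _ = ≤-trans (cnt-mono W λ _ e → true-∧ e refl) (m≤m+n _ 0)
  available-fresh (O ∷ Os) l (clO ∷ cls) = linear (size l) (available (fresh (O ∷ Os)) l + suc (length Os)) 0
    (+-mono-≤ (+-mono-≤ (available-fresh Os l cls) (cnt-∪ W split)) meets)
    (arith (size l) (available (fresh Os) l) (length Os) (available (fresh (O ∷ Os)) l) (cnt (λ z → class l z ∧ mem c O z) W))
    where
    arith : ∀ s a o b k → s + ((a + o) + (b + k) + 1) + 0 ≡ b + suc o + (s + a + k)
    arith = solve-∀
    split : ∀ {z} → z ∈ W → class l z ∧ fresh Os z ≡ true →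
            class l z ∧ fresh (O ∷ Os) z ≡ true ⊎ class l z ∧ mem c O z ≡ true
    split {z} _ e with mem c O z
    ... | false = inj₁ e
    ... | true  = inj₂ (true-∧ (proj₁ (∧-true {class l z} e)) refl)
    meets : cnt (λ z → class l z ∧ mem c O z) W ≤ 1
    meets = cnt-≤1 W! equal
      where
      equal : ∀ {x y} → x ∈ W → y ∈ W → class l x ∧ mem c O x ≡ true → class l y ∧ mem c O y ≡ true → x ≡ y
      equal {x} {y} x∈ y∈ ex ey with x ≟ᶠ y | ∧-true {class l x} ex | ∧-true {class l y} ey
      ... | yes x≡y | _       | _       = x≡y
      ... | no x≢y  | cx , mx | cy , my = ⊥-elim (not-blue x∈ y∈ (trans (class⁻ cx) (sym (class⁻ cy)))
              (AllPairs-lookup (E-sym c) clO (mem⁻ c mx) (mem⁻ c my) x≢y))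

  Fresh : List (Fin N) → List (List (Fin N)) → Fin N → Set
  Fresh K Os x = x ∈ K ⊎ (x ∈ W × All (x ∉_) Os)

  Extended : List (Fin N) → List (List (Fin N)) → ℕ → Set
  Extended K Os k = ∃ λ K′ → length K′ ≡ k × Clique c false K′ × All (Fresh K Os) K′

  Free : (Fin N → Bool) → List (Fin N) → List (List (Fin N)) → Set
  Free p K Os = ∀ {z} → p z ≡ true → All (λ x → E c false x z) K × All (z ∉_) Os

  free-fresh : ∀ Os → Free (fresh Os) [] Os
  free-fresh Os e = [] , fresh⁻ Os e

  free-blue : ∀ {p K Os} x → Free p K Os → Free (blue-to x p) (x ∷ K) Os
  free-blue x F {z} e with ∧-true {adj c false x z} e
  ... | xz , pz = xz ∷ proj₁ (F pz) , proj₂ (F pz)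

  next : ∀ {p K Os l} → Clique c false K → Free p K Os → 1 ≤ available p l →
         ∃ λ z → z ∈ W × f z ≡ l × Clique c false (z ∷ K) × All (z ∉_) Os
  next {p} {l = l} cl F 1≤ with cnt-pos W 1≤
  ... | z , z∈ , e with ∧-true {class l z} e
  ...   | cz , pz = z , z∈ , class⁻ cz , All.map (E-sym c) (proj₁ (F pz)) ∷ cl , proj₂ (F pz)

  extended-∷ : ∀ {K Os z k} → z ∈ W → All (z ∉_) Os → Extended (z ∷ K) Os k → Extended K Os k
  extended-∷ z∈ z∉ (K′ , len , cl , fr) = K′ , len , cl , All.map (λ where
    (inj₁ (here refl)) → inj₂ (z∈ , z∉)
    (inj₁ (there x∈))  → inj₁ x∈
    (inj₂ x)           → inj₂ x) fr

  -- The supply in every class pays in advance for all choices: passing class `j` lowers each later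
  -- supply by at most the amount by which the remaining cost drops.
  extend-along : ∀ js {p K Os} → Unique js → Clique c false K → Free p K Os →
                 (∀ {l} → l ∈ js → cost js < available p l) → Extended K Os (length js + length K)
  extend-along [] _ cl _ _ = _ , refl , cl , All.tabulate inj₁
  extend-along (j ∷ js) {p} {K} {Os} (j∉ ∷ js!) cl F room with next cl F (≤-trans (s≤s z≤n) (room (here refl)))
  ... | z , z∈ , refl , clz , z∉ = extended-∷ z∈ z∉
    (subst (Extended (z ∷ K) Os) (+-suc (length js) (length K))
      (extend-along js js! clz (free-blue z F) λ {l} l∈ →
        linear (suc (cost js)) (available (blue-to z p) l) 0
          (+-mono-≤ (+-mono-≤ (room (there l∈)) (available-blue p l z)) (reds-other z∈ (All.lookup j∉ l∈)))
          (arith (deficit (f z)) (cost js) (available p l) (available (blue-to z p) l) (reds l z))))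
    where
    arith : ∀ d c a b r → suc c + (a + (b + r) + suc d) + 0 ≡ b + (suc (suc d + c) + a + r)
    arith = solve-∀

  -- Equivalently, `x` has at most `p` blue neighbours in class `i`. The `p` other cliques block at
  -- most one vertex of a class each, so an unattached vertex keeps an unblocked blue neighbour in
  -- every class.
  Attached : ℕ → Fin N → Set
  Attached i x = size i < reds i x + suc p

  -- A single vertex is completed by one vertex from each of the `r` classes. An edge whose ends are
  -- attached to class `i` skips that class and takes one vertex from each of the other `r - 1`.
  data Seed : List (Fin N) → Set where
    single : ∀ {x} → (∀ {i} → i < r → ¬ Attached i x) → Seed (x ∷ [])
    edge   : ∀ {x y i} → i < r → Attached i x → Attached i y → E c false x y → Seed (x ∷ y ∷ [])

  seed-clique : ∀ {K} → Seed K → Clique c false K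
  seed-clique (single _)       = [] ∷ []
  seed-clique (edge _ _ _ xy) = (xy ∷ []) ∷ [] ∷ []

  others : ∀ {i} → i < r → ∃ λ js → downFrom r ↭ i ∷ js × i ∉ js × Unique js × suc (length js) ≡ r
  others i<r with pick (∈-downFrom⁺ i<r)
  ... | js , q with Unique-resp-↭ q (downFrom⁺ r)
  ...   | i∉ ∷ js! = js , q , (λ i∈ → All.lookup i∉ i∈ refl) , js! , trans (sym (↭-length q)) (List.length-downFrom r)

  cost-others : ∀ {i js} → downFrom r ↭ i ∷ js → suc (deficit i) + cost js ≡ Δ + r
  cost-others {i} {js} q = trans (sym (Σ-↭ (suc ∘ deficit) q))
    (trans (Σ-suc deficit (downFrom r)) (cong (Δ +_) (List.length-downFrom r)))

  two-deficits : ∀ {i js l} → downFrom r ↭ i ∷ js → l ∈ js → deficit i + deficit l ≤ Δ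
  two-deficits {i} {js} q l∈ = ≤-trans (+-monoʳ-≤ (deficit i) (term≤Σ deficit l∈)) (≤-reflexive (sym (Σ-↭ deficit q)))

  module _ (h₁ : 3 * Δ + 2 * r + 2 * p + 2 ≤ 2 * m) (h₂ : 2 * Δ + r + 3 * p + 2 ≤ 2 * m)
    {Os : List (List (Fin N))} (|Os| : length Os ≡ p) (clOs : All (Clique c false) Os) where

    -- Being red to all but `p` vertices of class `i` uses up most of the bound in `reds-two`.
    reds-attached : ∀ {x i l} → i ≢ l → Attached i x → reds l x ≤ deficit i + suc p
    reds-attached {x} {i} {l} i≢l att = linear (reds l x) (deficit i + suc p) 0
      (+-mono-≤ (+-mono-≤ att (reds-two x i≢l)) (≤-reflexive (sym (deficit+size i))))
      (arith (reds l x) (reds i x) (size i) (deficit i) p (2 * m))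
      where
      arith : ∀ a b s d p m → a + (b + suc p + (m + 1) + (d + s)) + 0 ≡ d + suc p + (suc s + (b + a) + m)
      arith = solve-∀

    extend-edge : ∀ {x y i} → i < r → Attached i x → Attached i y → E c false x y → Extended (x ∷ y ∷ []) Os (suc r)
    extend-edge {x} {y} {i} i<r ax ay xy with others i<r
    ... | js , q , i∉ , js! , len = subst (Extended (x ∷ y ∷ []) Os)
        (trans (+-suc _ 1) (cong suc (trans (+-comm _ 1) len)))
        (extend-along js js! ((xy ∷ []) ∷ [] ∷ []) (free-blue x (free-blue y (free-fresh Os))) room)
      where
      room : ∀ {l} → l ∈ js → cost js < available (blue-to x (blue-to y (fresh Os))) l
      -- In class `l` each of `x` and `y` removes at most `deficit i + p + 1` vertices and `Os`
      -- removes at most `p`. The deficits of `i` and `l` together are at most `Δ`, so `h₂` leaves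
      -- more than the cost.
      room {l} l∈ = linear (suc (cost js)) (available (blue-to x (blue-to y (fresh Os))) l) 0
        (+-mono-≤ (+-mono-≤ (+-mono-≤ (+-mono-≤ (+-mono-≤ (+-mono-≤ (+-mono-≤ (+-mono-≤ (+-mono-≤
          h₂ (two-deficits q l∈)) (reds-attached i≢l ax)) (reds-attached i≢l ay))
          (available-blue (blue-to y (fresh Os)) l x)) (available-blue (fresh Os) l y)) (available-fresh Os l clOs))
          (≤-reflexive |Os|)) (≤-reflexive (sym (deficit+size l)))) (≤-reflexive (cost-others q)))
        (arith Δ r p (2 * m) (deficit i) (deficit l) (reds l x) (reds l y) (available (blue-to x (blue-to y (fresh Os))) l)
           (available (blue-to y (fresh Os)) l) (available (fresh Os) l) (size l) (length Os) (cost js))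
        where
        i≢l : i ≢ l
        i≢l refl = i∉ l∈
        arith : ∀ D r p M di dl rx ry axy ay a s o cj →
          suc cj + (M + D + (di + suc p) + (di + suc p) + (axy + rx) + (ay + ry) + (a + o) + p + (dl + s) + (D + r)) + 0 ≡
          axy + (2 * D + r + 3 * p + 2 + (di + dl) + rx + ry + ay + a + s + o + M + (suc di + cj))
        arith = solve-∀

    -- At most one class can contain few blue neighbours of x; that class is served first.
    extend-single : ∀ {x} → (∀ {i} → i < r → ¬ Attached i x) → Extended (x ∷ []) Os (suc r)
    -- The threshold is the cost `Δ + r` of passing through all classes plus the `p` vertices
    -- blocked by `Os`.
    extend-single {x} ¬att with Any.any? (λ i → size i ≤? reds i x + (Δ + r + p)) (downFrom r)
    ... | no ¬small = subst (Extended (x ∷ []) Os) (trans (+-comm _ 1) (cong suc (List.length-downFrom r)))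
        (extend-along (downFrom r) (downFrom⁺ r) ([] ∷ []) (free-blue x (free-fresh Os)) room)
      where
      room : ∀ {l} → l ∈ downFrom r → cost (downFrom r) < available (blue-to x (fresh Os)) l
      room {l} l∈ = linear (suc (cost (downFrom r))) (available (blue-to x (fresh Os)) l) 0
        (+-mono-≤ (+-mono-≤ (+-mono-≤ (+-mono-≤ (≰⇒> (λ small → ¬small (lose l∈ small))) (available-blue (fresh Os) l x))
          (available-fresh Os l clOs)) (≤-reflexive |Os|))
          (≤-reflexive (trans (Σ-suc deficit (downFrom r)) (cong (Δ +_) (List.length-downFrom r)))))
        (arith Δ r p (size l) (reds l x) (available (fresh Os) l) (available (blue-to x (fresh Os)) l) (length Os) (cost (downFrom r)))
        where
        arith : ∀ D r p s rx a ax o cj →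
          suc cj + (s + (ax + rx) + (a + o) + p + (D + r)) + 0 ≡ ax + (suc (rx + (D + r + p)) + a + s + o + cj)
        arith = solve-∀
    ... | yes small with find small
    ...   | i , i∈ , xi with others (∈-downFrom⁻ i∈)
    ...     | js , q , i∉ , js! , len with next {l = i} ([] ∷ []) (free-blue x (free-fresh Os)) 1≤
      where
      1≤ : 1 ≤ available (blue-to x (fresh Os)) i
      -- Being unattached, `x` has at least `p + 1` blue neighbours in class `i`, and `Os` blocks at
      -- most `p`.
      1≤ = linear 1 (available (blue-to x (fresh Os)) i) 0
        (+-mono-≤ (+-mono-≤ (+-mono-≤ (≮⇒≥ (¬att (∈-downFrom⁻ i∈))) (available-blue (fresh Os) i x))
          (available-fresh Os i clOs)) (≤-reflexive |Os|))
        (arith p (size i) (reds i x) (available (fresh Os) i) (available (blue-to x (fresh Os)) i) (length Os))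
        where
        arith : ∀ p s rx a ax o → 1 + (s + (ax + rx) + (a + o) + p) + 0 ≡ ax + (rx + suc p + a + s + o)
        arith = solve-∀
    ...       | z , z∈ , refl , clz , z∉ = extended-∷ z∈ z∉ (subst (Extended (z ∷ x ∷ []) Os)
        (trans (+-suc _ 1) (cong suc (trans (+-comm _ 1) len)))
        (extend-along js js! clz (free-blue z (free-blue x (free-fresh Os))) room))
      where
      room : ∀ {l} → l ∈ js → cost js < available (blue-to z (blue-to x (fresh Os))) l
      -- Since `x` is blue to at most `Δ + r + p` vertices of class `f z`, `reds-two` bounds its
      -- loss in class `l` by `deficit (f z) + Δ + r + p + 1`. The vertex `z` costs
      -- `deficit (f z) + 1` more and `Os` costs `p`; `h₁` covers the sum.
      room {l} l∈ = linear (suc (cost js)) (available (blue-to z (blue-to x (fresh Os))) l) 0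
        (+-mono-≤ (+-mono-≤ (+-mono-≤ (+-mono-≤ (+-mono-≤ (+-mono-≤ (+-mono-≤ (+-mono-≤ (+-mono-≤ (+-mono-≤ (+-mono-≤
          h₁ (two-deficits q l∈)) (reds-other z∈ i≢l)) (reds-two x i≢l)) xi)
          (available-blue (blue-to x (fresh Os)) l z)) (available-blue (fresh Os) l x)) (available-fresh Os l clOs))
          (≤-reflexive |Os|)) (≤-reflexive (sym (deficit+size l)))) (≤-reflexive (sym (deficit+size (f z))))) (≤-reflexive (cost-others q)))
        (arith Δ r p (2 * m) (deficit (f z)) (deficit l) (reds l z) (reds l x) (reds (f z) x) (size (f z))
           (available (blue-to z (blue-to x (fresh Os))) l)
           (available (blue-to x (fresh Os)) l) (available (fresh Os) l) (size l) (length Os) (cost js))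
        where
        i≢l : f z ≢ l
        i≢l refl = i∉ l∈
        arith : ∀ D r p M di dl rz rx ri si azx ax a s o cj →
          suc cj + (M + D + suc di + (M + 1) + (ri + (D + r + p)) + (azx + rz) + (ax + rx) + (a + o) + p + (dl + s) + (di + si) + (D + r)) + 0 ≡
          azx + (3 * D + 2 * r + 2 * p + 2 + (di + dl) + rz + (ri + rx) + si + ax + a + s + o + M + M + (suc di + cj))
        arith = solve-∀

    extend : ∀ {K} → Seed K → Extended K Os (suc r)
    extend (single ¬att)      = extend-single ¬att
    extend (edge i<r ax ay e) = extend-edge i<r ax ay e

  -- Finding disjoint seeds and extending them together

  Seeds : List (Fin N) → ℕ → Set
  Seeds L k = ∃ λ Ks → length Ks ≡ k × All (λ K → Seed K × All (_∈ L) K) Ks × AllPairs _#_ Ks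

  singles : ∀ k {L} → Unique L → (∀ {x} → x ∈ L → Seed (x ∷ [])) → k ≤ length L → Seeds L k
  singles zero    _ _ _ = [] , refl , [] , []
  singles (suc k) {x ∷ L} (x∉ ∷ L!) s (s≤s le) with singles k L! (s ∘ there) le
  ... | Ks , len , good , dis = (x ∷ []) ∷ Ks , cong suc len ,
    (s (here refl) , here refl ∷ []) ∷ All.map (λ (sd , K⊆) → sd , All.map there K⊆) good ,
    All.map (λ (_ , K⊆) → (λ x∈K → All.lookup x∉ (All.lookup K⊆ x∈K) refl) ∷ []) good ∷ dis

  edges-in : ∀ {i L k} → i < r → (∀ {x} → x ∈ L → Attached i x) → Packing c false 2 L k → Seeds L k
  edges-in {i} {L} i<r att (Ks , (len , sizes) , cls , dis) = Ks , len , All.zipWith seed (sizes , cls) , dis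
    where
    seed : ∀ {K} → (length K ≡ 2 × All (_∈ L) K) × Clique c false K → Seed K × All (_∈ L) K
    seed {x ∷ y ∷ []} ((refl , K⊆@(x∈ ∷ y∈ ∷ [])) , ((e ∷ []) ∷ [] ∷ [])) = edge i<r (att x∈) (att y∈) e , K⊆

  seeds-++ : ∀ {L L₁ L₂ k₁ k₂} → (∀ {x} → x ∈ L₁ → x ∈ L) → (∀ {x} → x ∈ L₂ → x ∈ L) → L₁ # L₂ →
             Seeds L₁ k₁ → Seeds L₂ k₂ → Seeds L (k₁ + k₂)
  seeds-++ f₁ f₂ L₁#L₂ (Ks , refl , gK , dK) (Ls , refl , gL , dL) = Ks ++ Ls , List.length-++ Ks ,
    All.++⁺ (All.map (λ (s , K⊆) → s , All.map f₁ K⊆) gK) (All.map (λ (s , K⊆) → s , All.map f₂ K⊆) gL) ,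
    AllPairs.++⁺ dK dL (All.map (λ (_ , K⊆) → All.map (λ (_ , L⊆) →
      All.map (λ x∈₁ x∈L → All.lookup L₁#L₂ x∈₁ (All.lookup L⊆ x∈L)) K⊆) gL) gK)

  attached? : ∀ i x → Dec (Attached i x)
  attached? i x = size i Nat.<? reds i x + suc p

  -- Every vertex beyond the first 2m attached to a class yields a blue edge, and every unattached vertex a single seed.
  seeds : ∀ js k {L} → Unique L → All (_< r) js → (∀ {x i} → x ∈ L → i < r → i ∈ js ⊎ ¬ Attached i x) →
          k ≤ m → length js * (2 * m) + k ≤ length L → Seeds L k
  seeds [] k L! _ cover _ le = singles k L! (λ x∈ → single λ i<r → [ (λ ()) , id ]′ (cover x∈ i<r)) le
  seeds (j ∷ js) k {L} L! (j<r ∷ js<) cover k≤m le = result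
    where
    att : Fin N → Bool
    att x = does (attached? j x)
    Bⱼ = filterᵇ att L
    L′ = filterᵇ (not ∘ att) L
    Bⱼ⊆ : ∀ {x} → x ∈ Bⱼ → x ∈ L
    Bⱼ⊆ = proj₁ ∘ ∈-filterᵇ⁻ att L
    L′⊆ : ∀ {x} → x ∈ L′ → x ∈ L
    L′⊆ = proj₁ ∘ ∈-filterᵇ⁻ (not ∘ att) L
    B-att : ∀ {x} → x ∈ Bⱼ → Attached j x
    B-att {x} x∈ = does-true (attached? j x) (proj₂ (∈-filterᵇ⁻ att L x∈))
    L′-att : ∀ {x} → x ∈ L′ → ¬ Attached j x
    L′-att {x} x∈ a = false≢true (cong not (dec-true (attached? j x) a)) (proj₂ (∈-filterᵇ⁻ (not ∘ att) L x∈))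
    |Bⱼ|+|L′| : length Bⱼ + length L′ ≡ length L
    |Bⱼ|+|L′| = trans (cong₂ _+_ (length-filterᵇ att L) (length-filterᵇ (not ∘ att) L)) (cnt-split att L)
    cover′ : ∀ {x i} → x ∈ L′ → i < r → i ∈ js ⊎ ¬ Attached i x
    cover′ x∈ i<r with cover (L′⊆ x∈) i<r
    ... | inj₁ (here refl) = inj₂ (L′-att x∈)
    ... | inj₁ (there i∈)  = inj₁ i∈
    ... | inj₂ ¬a          = inj₂ ¬a
    Bⱼ#L′ : Bⱼ # L′
    Bⱼ#L′ = All.tabulate λ x∈Bⱼ x∈L′ → L′-att x∈L′ (B-att x∈Bⱼ)
    matching : ∀ e → e ≤ m → 2 * m + e ≤ length Bⱼ → Seeds Bⱼ e
    matching e e≤ le = edges-in j<r B-att (blue-matching c no-fan (AllPairs-filterᵇ att L!) e≤ le)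
    rest : ∀ e → length js * (2 * m) + e ≤ length L′ → e ≤ m → Seeds L′ e
    rest e le e≤ = seeds js e (AllPairs-filterᵇ (not ∘ att) L!) js< cover′ e≤ le
    result : Seeds L k
    result with 2 * m + k ≤? length Bⱼ | 2 * m ≤? length Bⱼ
    ... | yes big | _ = subst (Seeds L) (+-identityʳ k) (seeds-++ {L₂ = []} Bⱼ⊆ (λ ()) (All.tabulate λ _ ()) (matching k k≤m big) ([] , refl , [] , []))
    -- Fewer than `2m` attached vertices are simply discarded: removing `j` from the list lowers the
    -- required length by `2m`.
    ... | no ¬big | no small = seeds-++ {L₁ = []} (λ ()) L′⊆ [] ([] , refl , [] , []) (rest k
          (linear (length js * (2 * m) + k) (length L′) 1 (+-mono-≤ (+-mono-≤ le (≰⇒> small)) (≤-reflexive (sym |Bⱼ|+|L′|)))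
            (arith (length js) (2 * m) k (length L) (length Bⱼ) (length L′))) k≤m)
      where
      arith : ∀ j m k l b l′ → j * m + k + (l + m + (b + l′)) + 1 ≡ l′ + (suc j * m + k + suc b + l)
      arith = solve-∀
    ... | no ¬big | yes some with m≤n⇒∃[o]m+o≡n some
    ...   | e , eq = subst (Seeds L) (m+[n∸m]≡n (<⇒≤ e<k)) (seeds-++ Bⱼ⊆ L′⊆ Bⱼ#L′
          (matching e (≤-trans (<⇒≤ e<k) k≤m) (≤-reflexive eq))
          (rest (k ∸ e) (linear (length js * (2 * m) + (k ∸ e)) (length L′) 0
            (+-mono-≤ (+-mono-≤ (+-mono-≤ le (≤-reflexive (sym |Bⱼ|+|L′|))) (≤-reflexive (sym eq))) (≤-reflexive (m+[n∸m]≡n (<⇒≤ e<k))))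
            (arith (length js) (2 * m) k (length L) (length Bⱼ) (length L′) e (k ∸ e))) (≤-trans (m∸n≤m k e) k≤m)))
      where
      e<k : e < k
      e<k = +-cancelˡ-< (2 * m) e k (≤-trans (s≤s (≤-reflexive eq)) (≰⇒> ¬big))
      arith : ∀ j m k l b l′ e d → j * m + d + (l + (b + l′) + (m + e) + k) + 0 ≡ l′ + (suc j * m + k + l + b + (e + d))
      arith = solve-∀

  module _ (h₁ : 3 * Δ + 2 * r + 2 * p + 2 ≤ 2 * m) (h₂ : 2 * Δ + r + 3 * p + 2 ≤ 2 * m)
    {L : List (Fin N)} (W⊆L : ∀ {x} → x ∈ W → x ∈ L) where

    -- While one seed is extended, `Os` consists of the waiting seeds and the finished cliques,
    -- always `p` in total. Waiting seeds are avoided too, so they are still intact when their turn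
    -- comes.
    extend-all : ∀ todo done → length todo + length done ≡ suc p →
      All (λ K → Seed K × All (_∈ L) K) todo → AllPairs _#_ todo →
      All (Clique c false) done → All (λ K → All (K #_) done) todo →
      ∃ λ Ks → (length Ks ≡ length todo × All (λ K → length K ≡ suc r × All (_∈ L) K) Ks) ×
               (All (Clique c false) Ks × AllPairs _#_ Ks) × All (λ K → All (K #_) done) Ks
    extend-all [] done _ _ _ _ _ = [] , (refl , []) , ([] , []) , []
    extend-all (K ∷ todo) done len ((s , K⊆) ∷ good) (K# ∷ dis) cls (K#done ∷ todo#done)
      with extend h₁ h₂ {todo ++ done} (trans (List.length-++ todo) (suc-injective len))
             (All.++⁺ (All.map (seed-clique ∘ proj₁) good) cls) s
    ... | K′ , |K′| , cl′ , fr with extend-all todo (K′ ∷ done) (trans (+-suc _ _) len) good dis (cl′ ∷ cls)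
            (All.zipWith (λ (a , b) → a ∷ b) (All.map #-sym K′#todo , todo#done))
      where
      K′#todo : All (K′ #_) todo
      K′#todo = All.tabulate λ {T} T∈ → All.map (λ where
        (inj₁ x∈K)     → All.lookup (All.lookup K# T∈) x∈K
        (inj₂ (_ , x∉)) → All.lookup x∉ (∈-++⁺ˡ T∈)) fr
    ...   | Ks , (len′ , sizes) , (clKs , disKs) , Ks# =
      K′ ∷ Ks , (cong suc len′ , (|K′| , All.map [ All.lookup K⊆ , W⊆L ∘ proj₁ ]′ fr) ∷ sizes) ,
      (cl′ ∷ clKs , All.map (λ where (K#K′ ∷ _) → #-sym K#K′) Ks# ∷ disKs) ,
      K′#done ∷ All.map (λ where (_ ∷ d) → d) Ks#
      where
      K′#done : All (K′ #_) done
      K′#done = All.tabulate λ {T} T∈ → All.map (λ where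
        (inj₁ x∈K)     → All.lookup (All.lookup K#done T∈) x∈K
        (inj₂ (_ , x∉)) → All.lookup x∉ (∈-++⁺ʳ todo T∈)) fr

    blue-cliques : Unique L → suc p ≤ m → r * (2 * m) + suc p ≤ length L → Packing c false (suc r) L (suc p)
    blue-cliques L! p<m long with seeds (downFrom r) (suc p) L! (All.tabulate ∈-downFrom⁻) (λ _ → inj₁ ∘ ∈-downFrom⁺) p<m
                                    (subst (λ k → k * (2 * m) + suc p ≤ length L) (sym (List.length-downFrom r)) long)
    ... | Ss , len , good , dis with extend-all Ss [] (trans (+-identityʳ _) len) good dis [] (All.map (λ _ → []) good)
    ...   | Ks , (len′ , sizes) , rest , _ = Ks , (trans len′ len , sizes) , rest

-- The first inequality makes `W` dense enough for the Andrásfai-Erdős-Sós theorem. The second is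
-- `h₁` with `Δ` replaced by its upper bound `suc q * p`; after the same replacement `h₂` is weaker.
blue-packing : ∀ {N} (c : Colouring N) {m q p} → ¬ FanIn c true 2 m →
  q * (3 * q + 2) + 3 * suc q * p ≤ 2 * m → (3 * suc q + 2) * p + 2 * suc q + 2 ≤ 2 * m → suc p ≤ m →
  ∀ {L} → Unique L → suc q * (2 * m) + suc p ≤ length L → Packing c false (suc (suc q)) L (suc p)
blue-packing c {m} {q} {p} no-fan few-parts room p<m {L} L! long with pack-or-none c (suc (suc q)) p L!
... | inj₁ packing = packing
... | inj₂ (W , W! , W⊆L , none , |L|) with andrásfai-erdős-sós _≟ᶠ_ {W} {q} {2 * m + q} large
        (edges _≟ᶠ_ (ρ c) W W) (ρ c) ≤-refl (ρ-refl c) (ρ-sym c) none (λ _ → degree-bound c no-fan W! none)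
  where
  large : (3 * q + 2) * (2 * m + q) < 3 * length W
  large = linear (suc ((3 * q + 2) * (2 * m + q))) (3 * length W) 2
    (+-mono-≤ (+-mono-≤ (*-monoʳ-≤ 3 long) (*-monoʳ-≤ 3 |L|)) few-parts)
    (arith q (2 * m) p (length L) (length W))
    where
    arith : ∀ q M p l w → suc ((3 * q + 2) * (M + q)) + (3 * l + 3 * (w + p * suc (suc q)) + M) + 2 ≡
                          3 * w + (3 * (suc q * M + suc p) + 3 * l + (q * (3 * q + 2) + 3 * suc q * p))
    arith = solve-∀
...   | f , f< , same = blue-cliques h₁ h₂ W⊆L L! p<m long
  where
  open Extension c no-fan W! f same (suc q) p
  open Classes c no-fan W! f same using (size; deficit; deficit+size)
  all-true : ∀ {A : Set} (xs : List A) → cnt (λ _ → true) xs ≡ length xs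
  all-true []       = refl
  all-true (_ ∷ xs) = cong suc (all-true xs)
  |W| : length W ≤ Σ[ downFrom (suc q) ] size
  |W| = ≤-trans (≤-reflexive (sym (all-true W))) (cnt-cover f (λ _ → true) W (suc q) λ x∈ _ → f< x∈)
  total : Δ + Σ[ downFrom (suc q) ] size ≡ suc q * (2 * m)
  total = trans (Σ-const (downFrom (suc q)) deficit size (2 * m) (λ {j} _ → deficit+size j))
                (cong (_* (2 * m)) (List.length-downFrom (suc q)))
  Δ< : suc Δ ≤ suc q * p
  -- The `p (q + 2)` deleted vertices are partly offset by the surplus `p + 1`, so `W` has more than
  -- `(q + 1) (2m - p)` vertices.
  Δ< = linear (suc Δ) (suc q * p) 0 (+-mono-≤ (+-mono-≤ (+-mono-≤ long |L|) |W|) (≤-reflexive total))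
    (arith Δ q p (2 * m) (length L) (length W) (Σ[ downFrom (suc q) ] size))
    where
    arith : ∀ D q p M l w s → suc D + (l + (w + p * suc (suc q)) + s + suc q * M) + 0 ≡
                              suc q * p + (suc q * M + suc p + l + w + (D + s))
    arith = solve-∀
  h₁ : 3 * Δ + 2 * suc q + 2 * p + 2 ≤ 2 * m
  h₁ = linear (3 * Δ + 2 * suc q + 2 * p + 2) (2 * m) 3 (+-mono-≤ (*-monoʳ-≤ 3 Δ<) room) (arith Δ q p (2 * m))
    where
    arith : ∀ D q p M → 3 * D + 2 * suc q + 2 * p + 2 + (3 * (suc q * p) + M) + 3 ≡
                        M + (3 * suc D + ((3 * suc q + 2) * p + 2 * suc q + 2))
    arith = solve-∀
  h₂ : 2 * Δ + suc q + 3 * p + 2 ≤ 2 * m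
  h₂ = linear (2 * Δ + suc q + 3 * p + 2) (2 * m) (q * p + suc q + 2) (+-mono-≤ (*-monoʳ-≤ 2 Δ<) room) (arith Δ q p (2 * m))
    where
    arith : ∀ D q p M → 2 * D + suc q + 3 * p + 2 + (2 * (suc q * p) + M) + (q * p + suc q + 2) ≡
                        M + (2 * suc D + ((3 * suc q + 2) * p + 2 * suc q + 2))
    arith = solve-∀

-- From neighbourhoods to the Ramsey bound

degree-sum : ∀ {N} (c : Colouring N) v → N ≤ length (nbhd c true v) + (1 + length (nbhd c false v))
degree-sum {N} c v = ≤-trans (≤-reflexive (trans (sym (List.length-tabulate id)) (sym (cnt-split (adj c true v) (allFin N)))))
  (+-mono-≤ (≤-reflexive (sym (length-filterᵇ (adj c true v) (allFin N))))
    (≤-trans (cnt-∪ {q = λ w → does (v ≟ᶠ w)} {adj c false v} (allFin N) split)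
      (+-mono-≤ (cnt-eq≤1 c v (allFin⁺ N)) (≤-reflexive (sym (length-filterᵇ (adj c false v) (allFin N)))))))
  where
  split : ∀ {w} → w ∈ allFin N → not (adj c true v w) ≡ true → does (v ≟ᶠ w) ≡ true ⊎ adj c false v w ≡ true
  split {w} _ e = case v ≟ᶠ w of λ where
    (yes v≡w) → inj₁ (dec-true (v ≟ᶠ w) v≡w)
    (no v≢w)  → inj₂ (adj-other c true v≢w (not-true e))

arrows : ∀ {m q p} → q * (3 * q + 2) + 3 * suc q * p ≤ 2 * m →
  (3 * suc q + 2) * p + 2 * suc q + 2 ≤ 2 * m → suc p ≤ m → 3 * suc p ≤ 2 * m →
  ∀ {N} → N ≡ m + suc q * (2 * m + suc p) + suc p + m → RamseyLE (Fan m) (GenFan (suc (suc q)) (suc p)) N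
arrows {m} {q} {p} few-parts room p<m 3n≤2m {N} N≡ c with fan? c true 2 m
... | yes red = inj₁ (fan-copy c red)
... | no no-fan = inj₂ (fan-copy c (blue-fan (2 * m + suc p * suc q ≤? length (nbhd c true v))))
  where
  v : Fin N
  -- Any vertex will do; one exists because `m` is positive and at most `N`.
  v = fromℕ< {0} (≤-trans (s≤s z≤n) (≤-trans p<m (≤-trans (m≤n+m m _) (≤-reflexive (sym N≡)))))
  blue-fan : Dec (2 * m + suc p * suc q ≤ length (nbhd c true v)) → FanIn c false (suc (suc q)) (suc p)
  blue-fan (yes many-red) with blue-fan-in-red-nbhd c {m} {suc p} {suc q} (s≤s z≤n) 3n≤2m (AllPairs-filterᵇ (adj c true v) (allFin⁺ N)) many-red
  ... | inj₁ red  = ⊥-elim (no-fan (v , red))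
  ... | inj₂ blue = blue
  blue-fan (no few-red) = v , blue-packing c no-fan few-parts room p<m (AllPairs-filterᵇ (adj c false v) (allFin⁺ N))
    (linear (suc q * (2 * m) + suc p) (length (nbhd c false v)) 0
      (+-mono-≤ (+-mono-≤ (≰⇒> few-red) (degree-sum c v)) (≤-reflexive (sym N≡)))
      (arith m q p N (length (nbhd c true v)) (length (nbhd c false v))))
    where
    arith : ∀ m q p N R B → suc q * (2 * m) + suc p + (2 * m + suc p * suc q + (R + (1 + B)) + N) + 0 ≡
                            B + (suc R + N + (m + suc q * (2 * m + suc p) + suc p + m))
    arith = solve-∀

theorem1p11 : (t : ℕ) → 3 ≤ t → ∃ λ C →
    (n m : ℕ) → 1 ≤ n → 1 ≤ m →
    (t + 1) * (t + C + 2) + 3 ≤ 2 * m →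
    (t ∸ 1) * (t ∸ 1) * ((n ∸ 1) * (t ∸ 1) + 2) ≤ 2 * m * (t ∸ 2) →
    RamseyLE (Fan m) (GenFan t n) ((m ⊔ n) + (t ∸ 1) * (2 * m + n) + n + m)
theorem1p11 (suc (suc (suc a))) (s≤s (s≤s (s≤s z≤n))) = (3 * q + 4) * (q * (3 * q + 2)) , bound
  where
  -- The constant covers the additive term K of the Andrásfai–Erdős–Sós condition while 2 (n - 1) < K.
  q = suc a
  K = q * (3 * q + 2)
  bound : (n m : ℕ) → 1 ≤ n → 1 ≤ m →
    (suc (suc q) + 1) * (suc (suc q) + (3 * q + 4) * K + 2) + 3 ≤ 2 * m →
    suc q * suc q * ((n ∸ 1) * suc q + 2) ≤ 2 * m * q →
    RamseyLE (Fan m) (GenFan (suc (suc q)) n) ((m ⊔ n) + suc q * (2 * m + n) + n + m)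
  bound (suc p) m _ _ C≤ n≤ = arrows {m} {q} {p} few-parts room p<m 3n≤2m
      (cong (λ k → k + suc q * (2 * m + suc p) + suc p + m) (m≥n⇒m⊔n≡m p<m))
    where
    room : (3 * suc q + 2) * p + 2 * suc q + 2 ≤ 2 * m
    -- After multiplication by `q` the coefficients of `p` are `(3 q + 5) q` and `(q + 1)` cubed.
    -- They agree for `q = 1`, that is `t = 3`, and differ by `a (a a + 3 a + 1)` in general.
    room = *-cancelʳ-≤ _ _ q (≤-trans (linear (((3 * suc q + 2) * p + 2 * suc q + 2) * q) (2 * m * q) (a * (a * a + 3 * a + 1) * p + 2) n≤
             (arith a p (2 * m))) ≤-refl)
      where
      arith : ∀ a p M → ((3 * suc (suc a) + 2) * p + 2 * suc (suc a) + 2) * suc a + M * suc a + (a * (a * a + 3 * a + 1) * p + 2) ≡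
                        M * suc a + suc (suc a) * suc (suc a) * (p * suc (suc a) + 2)
      arith = solve-∀
    C≤2m : (3 * q + 4) * K ≤ 2 * m
    C≤2m = linear ((3 * q + 4) * K) (2 * m) ((q + 2) * ((3 * q + 4) * K) + (suc (suc q) + 1) * (suc (suc q) + 2) + 3) C≤
             (arith q ((3 * q + 4) * K) (2 * m))
      where
      arith : ∀ q C M → C + M + ((q + 2) * C + (suc (suc q) + 1) * (suc (suc q) + 2) + 3) ≡ M + ((suc (suc q) + 1) * (suc (suc q) + C + 2) + 3)
      arith = solve-∀
    few-parts : K + 3 * suc q * p ≤ 2 * m
    -- For large `p` the summand `2 p` contained in `room` pays for `K`. Otherwise `p ≤ K`, and the
    -- left side is at most `K + 3 (q + 1) K = (3 q + 4) K`.
    few-parts with K ≤? 2 * p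
    ... | yes K≤ = linear (K + 3 * suc q * p) (2 * m) (2 * suc q + 2) (+-mono-≤ K≤ room) (arith q p K (2 * m))
      where
      arith : ∀ q p K M → K + 3 * suc q * p + (2 * p + M) + (2 * suc q + 2) ≡ M + (K + ((3 * suc q + 2) * p + 2 * suc q + 2))
      arith = solve-∀
    ... | no K≰ = linear (K + 3 * suc q * p) (2 * m) 0 (+-mono-≤ (*-monoʳ-≤ (3 * suc q) p≤K) C≤2m) (arith q p K (2 * m))
      where
      p≤K : p ≤ K
      p≤K = ≤-trans (m≤m+n p _) (<⇒≤ (≰⇒> K≰))
      arith : ∀ q p K M → K + 3 * suc q * p + (3 * suc q * K + M) + 0 ≡ M + (3 * suc q * p + (3 * q + 4) * K)
      arith = solve-∀
    3n≤2m : 3 * suc p ≤ 2 * m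
    3n≤2m = linear (3 * suc p) (2 * m) (3 * q * p + 2 * p + 2 * q + 1) room (arith q p (2 * m))
      where
      arith : ∀ q p M → 3 * suc p + M + (3 * q * p + 2 * p + 2 * q + 1) ≡ M + ((3 * suc q + 2) * p + 2 * suc q + 2)
      arith = solve-∀
    p<m : suc p ≤ m
    p<m = *-cancelˡ-≤ 2 (≤-trans (*-monoˡ-≤ (suc p) (s≤s (s≤s (z≤n {1})))) 3n≤2m)
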